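{- Let $d\ge3$, let $s\in[\tfrac14,\tfrac12]$, and suppose that $E\subseteq S_j\subset\mathbb{F}_q^d$, with $j\in\mathbb{F}_q$, $j\neq0$, is a $(4,s)$-Salem set. If $$|E|\gg q^{\frac{d+1}{4s+1}},$$ then $|\Delta(E)|\gg q$.
   Context: $\mathbb{F}_q$ is a finite field of odd order $q$; for $\mathbf{x}\in\mathbb{F}_q^d$, $\|\mathbf{x}\|=x_1^2+\cdots+x_d^2$; $S_j=\{\mathbf{x}\in\mathbb{F}_q^d:\|\mathbf{x}\|=j\}$; $\Delta(E)=\{\|\mathbf{x}-\mathbf{y}\|:\mathbf{x},\mathbf{y}\in E\}$. Fix a nontrivial additive character $\chi$ of $\mathbb{F}_q$ and put $\widehat{E}(\mathbf{x})=q^{ -d}\sum_{\mathbf{y}\in E}\chi(-\mathbf{x}\cdot\mathbf{y})$ and $\|\widehat{E}\|_4=\big(q^{ -d}\sum_{\mathbf{x}\in\mathbb{F}_q^d\setminus\{\mathbf{0}\}}|\widehat{E}(\mathbf{x})|^4\big)^{1/4}$. A set $E\subseteq\mathbb{F}_q^d$ is $(4,s)$-Salem if $\|\widehat{E}\|_4\ll q^{ -d}|E|^{1-s}$. Notation: $A\ll B$ (equivalently $B\gg A$) means $A\le CB$ for a constant $C>0$ not depending on $q$ or on the sets involved. Implied constants in conclusions may depend on $d$, $s$ and on the implied constants in the hypotheses (including the one in the Salem condition). -}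

module Defs where

open import Level using (_⊔_) renaming (suc to lsuc)
open import Algebra.Apartness.Structures using (IsHeytingField)
open import Algebra.Bundles using (CommutativeRing; RawMonoid; Semiring)
import Algebra.Definitions
import Algebra.Definitions.RawSemiring
open import Algebra.Morphism.Structures using (IsMonoidHomomorphism)
import Algebra.Properties.Ring
open import Data.Fin.Base using (Fin)
open import Data.Fin.Properties using (nonZeroIndex)
import Data.Fin.Properties as Fin
open import Data.List.Base
  using (List; [_]; map; foldr; filter; length; allFin;
         cartesianProductWith; deduplicate)
open import Data.List.Relation.Unary.All using (All)
import Data.List.Relation.Unary.Unique.Setoid as Unique
open import Data.Nat.Base as ℕ using (ℕ; zero; suc; NonZero)
open import Data.Product.Base using (∃-syntax; _×_; _,_; proj₁; proj₂)
open import Data.Sum.Base using (_⊎_; inj₁; inj₂)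
import Data.Vec.Functional as Vector
open Vector using (Vector)
import Data.Vec.Functional.Relation.Binary.Equality.Setoid as VectorEquality
import Data.Vec.Functional.Relation.Binary.Pointwise.Properties as Pointwise
open import Function.Bundles using (Inverse)
open import Function.Properties.Inverse using (Inverse⇒Injection)
open import Relation.Binary.Core using (Rel)
open import Relation.Binary.Definitions using (Decidable)
import Relation.Binary.PropositionalEquality.Properties as ≡
open import Relation.Binary.Structures using (IsStrictPartialOrder)
open import Relation.Nullary.Decidable using (via-injection; ¬?)
open import Relation.Nullary.Negation using (¬_; contradiction)

-- The real numbers, presented by their axioms: a Cauchy-complete
-- Archimedean ordered field, which is unique up to isomorphism.  The
-- axioms are the constructive ones (no decidable order); in particular
-- x ≤ y is the negation of y < x.
--
-- `exp` and `log` add no freedom: the real exponential is the only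
-- homomorphism from (ℝ, +) to (ℝ>0, *) with 1 + x ≤ exp x.

record RealNumbers c ℓ₁ ℓ₂ : Set (lsuc (c ⊔ ℓ₁ ⊔ ℓ₂)) where
  infix  8 -_
  infixl 7 _*_
  infixl 6 _+_
  infix  4 _≈_ _<_ _≤_ _#_
  field
    ℝ   : Set c
    _≈_ : Rel ℝ ℓ₁
    _<_ : Rel ℝ ℓ₂
    _+_ : ℝ → ℝ → ℝ
    _*_ : ℝ → ℝ → ℝ
    -_  : ℝ → ℝ
    0#  : ℝ
    1#  : ℝ

  _#_ : Rel ℝ ℓ₂
  x # y = x < y ⊎ y < x

  _≤_ : Rel ℝ ℓ₂
  x ≤ y = ¬ (y < x)

  field
    isHeytingField       : IsHeytingField _≈_ _#_ _+_ _*_ -_ 0# 1#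
    isStrictPartialOrder : IsStrictPartialOrder _≈_ _<_
    0<1                  : 0# < 1#
    +-monoˡ-<            : ∀ {x y} z → x < y → x + z < y + z
    *-pos                : ∀ {x y} → 0# < x → 0# < y → 0# < x * y

  open IsHeytingField isHeytingField public
    using (isCommutativeRing; #⇒invertible; invertible⇒#; #-cotrans; tight)
  open IsStrictPartialOrder isStrictPartialOrder public
    using (<-resp-≈)
    renaming (irrefl to <-irrefl; trans to <-trans)

  commutativeRing : CommutativeRing c ℓ₁
  commutativeRing = record { isCommutativeRing = isCommutativeRing }

  open CommutativeRing commutativeRing public
    using (ring; semiring; refl; sym; trans; _-_;
           -‿cong; +-congˡ; +-identityˡ; +-identityʳ; -‿inverseʳ;
           *-congʳ; *-comm)

  open Algebra.Definitions.RawSemiring (Semiring.rawSemiring semiring) public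
    using (_^_) renaming (_×_ to _×#_)

  fromℕ : ℕ → ℝ
  fromℕ n = n ×# 1#

  field
    archimedean : ∀ x → ∃[ n ] x < fromℕ n
    complete    : (a : ℕ → ℝ) →
                  (∀ ε → 0# < ε → ∃[ N ] ∀ m n → N ℕ.≤ m → N ℕ.≤ n →
                     a m - a n < ε) →
                  ∃[ x ] ∀ ε → 0# < ε → ∃[ N ] ∀ n → N ℕ.≤ n →
                     a n - x < ε × x - a n < ε

    exp     : ℝ → ℝ
    exp-+   : ∀ x y → exp (x + y) ≈ exp x * exp y
    exp-pos : ∀ x → 0# < exp x
    exp-mono-< : ∀ {x y} → x < y → exp x < exp y
    exp-cong   : ∀ {x y} → x ≈ y → exp x ≈ exp y
    1+x≤exp : ∀ x → 1# + x ≤ exp x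
    log     : ∀ x → 0# < x → ℝ
    exp-log : ∀ x (p : 0# < x) → exp (log x p) ≈ x

module Reals {c ℓ₁ ℓ₂} (R : RealNumbers c ℓ₁ ℓ₂) where
  open RealNumbers R public
  open Algebra.Properties.Ring ring using (-‿distribʳ-*; -0#≈0#)

  private
    <-respʳ : ∀ {x y z} → y ≈ z → x < y → x < z
    <-respʳ = proj₁ <-resp-≈

    x-0≈x : ∀ x → x - 0# ≈ x
    x-0≈x x = trans (+-congˡ -0#≈0#) (+-identityʳ x)

    0<-y : ∀ {y} → y < 0# → 0# < - y
    0<-y {y} y<0 = <-respʳ (+-identityˡ (- y))
      (proj₂ <-resp-≈ (-‿inverseʳ y) (+-monoˡ-< (- y) y<0))

    +-pos : ∀ {x y} → 0# < x → 0# < y → 0# < x + y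
    +-pos {x} {y} 0<x 0<y = <-trans 0<y
      (proj₂ <-resp-≈ (+-identityˡ y) (+-monoˡ-< y 0<x))

    ¬neg*pos≈1 : ∀ {x y} → 0# < x → y < 0# → ¬ (x * y ≈ 1#)
    ¬neg*pos≈1 {x} {y} 0<x y<0 xy≈1 = <-irrefl refl
      (<-respʳ 1-1≈0 (+-pos 0<1 (<-respʳ x*-y≈-1 (*-pos 0<x (0<-y y<0)))))
      where
      x*-y≈-1 : x * - y ≈ - 1#
      x*-y≈-1 = trans (sym (-‿distribʳ-* x y)) (-‿cong xy≈1)
      1-1≈0 : 1# + - 1# ≈ 0#
      1-1≈0 = -‿inverseʳ 1#

  infix 8 _⁻¹[_]
  _⁻¹[_] : ∀ x → 0# < x → ℝ
  x ⁻¹[ 0<x ] = proj₁ (#⇒invertible {x} {0#} (inj₂ 0<x))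

  infixl 7 _÷_[_]
  _÷_[_] : ℝ → ∀ y → 0# < y → ℝ
  x ÷ y [ 0<y ] = x * y ⁻¹[ 0<y ]

  ⁻¹-inverseʳ : ∀ x (0<x : 0# < x) → x * x ⁻¹[ 0<x ] ≈ 1#
  ⁻¹-inverseʳ x 0<x with #⇒invertible {x} {0#} (inj₂ 0<x)
  ... | y , _ , xy≈1 = trans (*-congʳ (sym (x-0≈x x))) xy≈1

  ⁻¹-pos : ∀ x (0<x : 0# < x) → 0# < x ⁻¹[ 0<x ]
  ⁻¹-pos x 0<x with invertible⇒# {x ⁻¹[ 0<x ]} {0#} (x , xy , yx)
    where
    yx : (x ⁻¹[ 0<x ] - 0#) * x ≈ 1#
    yx = trans (*-congʳ (x-0≈x _)) (trans (*-comm _ _) (⁻¹-inverseʳ x 0<x))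
    xy : x * (x ⁻¹[ 0<x ] - 0#) ≈ 1#
    xy = trans (*-comm _ _) yx
  ... | inj₁ y<0 = contradiction (⁻¹-inverseʳ x 0<x) (¬neg*pos≈1 0<x y<0)
  ... | inj₂ 0<y = 0<y

  <-≤-trans : ∀ {x y z} → x < y → y ≤ z → x < z
  <-≤-trans {x} {y} {z} x<y y≤z with #-cotrans (inj₁ x<y) z
  ... | inj₁ (inj₁ x<z) = x<z
  ... | inj₁ (inj₂ z<x) = contradiction (<-trans z<x x<y) y≤z
  ... | inj₂ (inj₁ z<y) = contradiction z<y y≤z
  ... | inj₂ (inj₂ y<z) = <-trans x<y y<z

  fromℕ-pos : ∀ n .{{_ : NonZero n}} → 0# < fromℕ n
  fromℕ-pos (suc zero)    = <-respʳ (sym (+-identityʳ 1#)) 0<1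
  fromℕ-pos (suc (suc n)) = +-pos 0<1 (fromℕ-pos (suc n))

  1/_ : ∀ n .{{_ : NonZero n}} → ℝ
  1/ n = fromℕ n ⁻¹[ fromℕ-pos n ]

  -- Real powers of natural numbers.  The value at base 0 is the usual
  -- one for positive exponents, and junk otherwise.
  infixr 8 _^ʳ_
  _^ʳ_ : ℕ → ℝ → ℝ
  zero  ^ʳ x = 0#
  suc n ^ʳ x = exp (x * log (fromℕ (suc n)) (fromℕ-pos (suc n)))

  0<4s+1 : ∀ {s} → 1/ 4 ≤ s → 0# < fromℕ 4 * s + 1#
  0<4s+1 1/4≤s =
    +-pos (*-pos (fromℕ-pos 4) (<-≤-trans (⁻¹-pos _ (fromℕ-pos 4)) 1/4≤s)) 0<1

module Complex {c ℓ₁ ℓ₂} (R : RealNumbers c ℓ₁ ℓ₂) where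
  open Reals R

  infix  4 _≈ᶜ_
  infixl 6 _+ᶜ_
  infixl 7 _*ᶜ_ _·ᶜ_

  record ℂ : Set c where
    constructor _+i_
    field
      re im : ℝ
  open ℂ public

  _≈ᶜ_ : Rel ℂ ℓ₁
  z ≈ᶜ w = re z ≈ re w × im z ≈ im w

  0ᶜ 1ᶜ : ℂ
  0ᶜ = 0# +i 0#
  1ᶜ = 1# +i 0#

  _+ᶜ_ _*ᶜ_ : ℂ → ℂ → ℂ
  z +ᶜ w = (re z + re w) +i (im z + im w)
  z *ᶜ w = (re z * re w - im z * im w) +i (re z * im w + im z * re w)

  _·ᶜ_ : ℝ → ℂ → ℂ
  a ·ᶜ z = (a * re z) +i (a * im z)

  ∣_∣² : ℂ → ℝ
  ∣ z ∣² = re z ^ 2 + im z ^ 2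

  *-rawMonoid : RawMonoid c ℓ₁
  *-rawMonoid = record { Carrier = ℂ ; _≈_ = _≈ᶜ_ ; _∙_ = _*ᶜ_ ; ε = 1ᶜ }

record FiniteField c ℓ : Set (lsuc (c ⊔ ℓ)) where
  field
    commutativeRing : CommutativeRing c ℓ

  open CommutativeRing commutativeRing public
  open Algebra.Definitions _≈_ using (Invertible)

  field
    1≉0         : 1# ≉ 0#
    ≉0⇒inverse  : ∀ x → x ≉ 0# → Invertible 1# _*_ x
    order       : ℕ
    enumeration : Inverse setoid (≡.setoid (Fin order))

  instance
    order-nonZero : NonZero order
    order-nonZero = nonZeroIndex (Inverse.to enumeration 0#)

  infix 4 _≟_
  _≟_ : Decidable _≈_
  _≟_ = via-injection (Inverse⇒Injection enumeration) Fin._≟_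

  elements : List Carrier
  elements = map (Inverse.from enumeration) (allFin order)

module Space {c ℓ} (F : FiniteField c ℓ) where
  open FiniteField F
  open Algebra.Definitions.RawSemiring (Semiring.rawSemiring semiring) using (sum; _^_)
  open VectorEquality setoid public using (_≋_; ≋-setoid)

  infixl 7 _∙_
  infixl 6 _-ᵛ_
  infix  4 _≋?_

  0ᵛ : ∀ {d} → Vector Carrier d
  0ᵛ _ = 0#

  _-ᵛ_ : ∀ {d} → Vector Carrier d → Vector Carrier d → Vector Carrier d
  _-ᵛ_ = Vector.zipWith _-_

  _∙_ : ∀ {d} → Vector Carrier d → Vector Carrier d → Carrier
  x ∙ y = sum (Vector.zipWith _*_ x y)

  ‖_‖ : ∀ {d} → Vector Carrier d → Carrier
  ‖ x ‖ = sum (Vector.map (_^ 2) x)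

  _≋?_ : ∀ {d} → Decidable (_≋_ {d})
  _≋?_ = Pointwise.decidable _≟_

  vectors : ∀ d → List (Vector Carrier d)
  vectors zero    = [ Vector.[] ]
  vectors (suc d) = cartesianProductWith Vector._∷_ elements (vectors d)

  nonZeroVectors : ∀ d → List (Vector Carrier d)
  nonZeroVectors d = filter (λ x → ¬? (x ≋? 0ᵛ)) (vectors d)

  record FiniteSubset d : Set (c ⊔ ℓ) where
    field
      points : List (Vector Carrier d)
      unique : Unique.Unique (≋-setoid d) points

    card : ℕ
    card = length points

  open FiniteSubset public

  infix 4 _⊆S_
  _⊆S_ : ∀ {d} → FiniteSubset d → Carrier → Set (c ⊔ ℓ)
  E ⊆S j = All (λ x → ‖ x ‖ ≈ j) (points E)

  -- the list has no repetitions, so its length is |Δ(E)|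
  Δ : ∀ {d} → FiniteSubset d → List Carrier
  Δ E = deduplicate _≟_
    (cartesianProductWith (λ x y → ‖ x -ᵛ y ‖) (points E) (points E))

module Fourier {r ℓ₁ ℓ₂ f ℓ} (R : RealNumbers r ℓ₁ ℓ₂) (F : FiniteField f ℓ) where
  open Reals R
  open Complex R
  open Space F
  private module F = FiniteField F
  open F using (order)

  record AdditiveCharacter : Set (r ⊔ ℓ₁ ⊔ f ⊔ ℓ) where
    field
      χ        : F.Carrier → ℂ
      χ-homo   : IsMonoidHomomorphism F.+-rawMonoid *-rawMonoid χ
      χ-circle : ∀ a → ∣ χ a ∣² ≈ 1#

  Nontrivial : AdditiveCharacter → Set (ℓ₁ ⊔ f)
  Nontrivial ψ = ∃[ a ] ¬ (χ a ≈ᶜ 1ᶜ)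
    where open AdditiveCharacter ψ

  module _ (ψ : AdditiveCharacter) {d : ℕ} (E : FiniteSubset d) where
    open AdditiveCharacter ψ

    q⁻ᵈ : ℝ
    q⁻ᵈ = (1/ order) ^ d

    Ê : Vector F.Carrier d → ℂ
    Ê x = q⁻ᵈ ·ᶜ foldr (λ y z → χ (F.- (x ∙ y)) +ᶜ z) 0ᶜ (points E)

    -- N = ‖Ê‖₄: the nonnegative fourth root of q⁻ᵈ ∑_{x ≠ 0} |Ê(x)|⁴
    IsL⁴Norm : ℝ → Set (ℓ₁ ⊔ ℓ₂)
    IsL⁴Norm N = 0# ≤ N ×
      N ^ 4 ≈ q⁻ᵈ * foldr (λ x t → ∣ Ê x ∣² ^ 2 + t) 0# (nonZeroVectors d)

    -- (4,s)-Salem with implied constant C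
    Is4Salem : (s C : ℝ) → Set (r ⊔ ℓ₁ ⊔ ℓ₂)
    Is4Salem s C =
      ∃[ N ] IsL⁴Norm N × N ≤ C * (q⁻ᵈ * card E ^ʳ (1# - s))

{-# OPTIONS --safe #-}

-- On a sphere ‖x − y‖ = ‖x − z‖ amounts to x∙(y − z) = 0, because q is odd.  Let M
-- be the number of triples (x, y, z) in E with this property.  By Cauchy–Schwarz
-- |E|³ ≤ |Δ(E)| M, and by orthogonality of characters
--
--   q M = ∑_{x ∈ E} ∑_s |S(s x)|² = |E|³ + T,   S = q^d Ê,
--
-- where T collects the terms with s ≠ 0.  The map (s, x) ↦ s x is at most two-to-one
-- on 𝔽_q^* × E, since ‖s x‖ = s² j, so Cauchy–Schwarz gives
-- T² ≤ 2 q |E| ∑_{v ≠ 0} |S(v)|⁴, and the Salem condition bounds this by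
-- 2 C⁴ q^(d+1) |E|^(5−4s).  The hypothesis says that q^(d+1) ≪ |E|^(4s+1), whence
-- T ≪ |E|³, so that M ≪ |E|³ / q and |Δ(E)| ≫ q.

module Submission where

-- The exponent in the hypothesis is the one for which s drops out: the bound 2 C⁴ q^(d+1)
-- |E|^(5-4s) for T², with q^(d+1) traded for |E|^(4s+1), leaves a multiple of |E|^6. Accordingly
-- |E|^(4-4s) and |E|^(4s) are carried as two separate factors, and all that is ever used of them is
-- that their product is |E|^4.
--
-- The axioms for the reals give no decidable order, which shapes the analytic steps. Since x ≤ y is
-- a negation, it may be proved by cases and equality inherits this, whereas x < y may not; so
-- estimates are stated with ≤, and strict positivity is kept for the quantities that get cancelled.
-- No square root is taken: bounds on T come from comparing squares.
--
-- Complex arithmetic is avoided too. The quantity |S|² is real and expands into cosines of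
-- differences, so orthogonality is needed only for the real part of a character sum.

open import Defs
open import Level using (Level)
open import Algebra.Bundles using (CommutativeMonoid; CommutativeRing; RawRing)
open import Algebra.Morphism.Structures using (IsMonoidHomomorphism)
import Algebra.Properties.AbelianGroup
import Algebra.Properties.CommutativeMonoid.Sum
import Algebra.Properties.Ring
import Algebra.Properties.Semiring.Exp
import Algebra.Properties.Semiring.Mult
import Algebra.Solver.Ring
open import Algebra.Solver.Ring.AlmostCommutativeRing
  using (fromCommutativeRing; _-Raw-AlmostCommutative⟶_)
import Algebra.Solver.Ring.NaturalCoefficients.Default
open import Data.Fin.Base using (Fin; zero; suc)
open import Data.Fin.Permutation using (permutation)
open import Data.List.Base
  using (List; []; _∷_; allFin; cartesianProductWith; foldr; length; map; tabulate)
open import Data.List.Membership.Propositional.Properties using (∈-allFin)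
import Data.List.Membership.Setoid.Properties as Membership
open import Data.List.Properties using (length-map; length-tabulate)
open import Data.List.Relation.Unary.All as All using (All; []; _∷_)
open import Data.List.Relation.Unary.All.Properties using (¬Any⇒All¬)
open import Data.List.Relation.Unary.AllPairs using (AllPairs; []; _∷_)
open import Data.List.Relation.Unary.Any as Any using (Any; any?; here; there)
import Data.List.Relation.Unary.Any.Properties as Any
import Data.List.Relation.Unary.Unique.DecSetoid.Properties as UniqueDec
import Data.List.Relation.Unary.Unique.Propositional.Properties as UniqueP
import Data.List.Relation.Unary.Unique.Setoid as Unique
import Data.List.Relation.Unary.Unique.Setoid.Properties as Unique
open import Data.Maybe.Base using (Maybe; just; nothing)
open import Data.Nat.Base as ℕ using (ℕ; NonZero; suc; zero)
open import Data.Nat.DivMod using (_%_; _/_; m%n<n; m≡m%n+[m/n]*n)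
open import Data.Nat.Divisibility using (_∤_; m%n≡0⇒n∣m)
import Data.Nat.Properties as ℕ
open import Data.Product.Base using (_,_; _×_; ∃-syntax; proj₁; proj₂)
open import Data.Sum.Base using (_⊎_; inj₁; inj₂)
import Data.Vec.Functional as Vector
open Vector using (Vector)
open import Function.Base using (_∘_; id)
open import Function.Bundles using (Inverse)
open import Relation.Binary.Bundles using (DecSetoid; Poset)
open import Relation.Binary.Core using (Rel)
import Relation.Binary.PropositionalEquality as ≡
open ≡ using (_≡_)
import Relation.Binary.Reasoning.PartialOrder
import Relation.Binary.Reasoning.Setoid
open import Relation.Nullary using (Dec; no; yes; ¬_; contradiction)
open import Relation.Nullary.Decidable using (_×-dec_; ¬?)
open import Relation.Unary using (Pred)

-- The pair (m , n) is the integer coefficient m − n; the solver only needs to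
-- recognise that coefficients agree, and m + n' ≡ m' + n does so.
module RingSolver {a ℓ} (R : CommutativeRing a ℓ) where
  open CommutativeRing R
  open Algebra.Properties.Ring ring using (-‿distribˡ-*; -‿distribʳ-*; -0#≈0#; -‿involutive)
  open Algebra.Properties.AbelianGroup +-abelianGroup using (⁻¹-∙-comm)
  open Algebra.Properties.Semiring.Mult semiring
    renaming (_×_ to _×#_) using (×-homo-+; ×1-homo-*; ×-congˡ)
  open Relation.Binary.Reasoning.Setoid setoid
  private
    module NS = Algebra.Solver.Ring.NaturalCoefficients.Default commutativeSemiring

    ι : ℕ → Carrier
    ι n = n ×# 1#

    ⟦_⟧ᶜ : ℕ × ℕ → Carrier
    ⟦ m , n ⟧ᶜ = ι m - ι n

    Coeff : RawRing _ _
    Coeff = record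
      { Carrier = ℕ × ℕ
      ; _≈_ = _≡_
      ; _+_ = λ (m , n) (m′ , n′) → m ℕ.+ m′ , n ℕ.+ n′
      ; _*_ = λ (m , n) (m′ , n′) → m ℕ.* m′ ℕ.+ n ℕ.* n′ , m ℕ.* n′ ℕ.+ n ℕ.* m′
      ; -_ = λ (m , n) → n , m
      ; 0# = 0 , 0
      ; 1# = 1 , 0
      }

    ι-+* : ∀ m n m′ n′ → ι (m ℕ.* m′ ℕ.+ n ℕ.* n′) ≈ ι m * ι m′ + ι n * ι n′
    ι-+* m n m′ n′ = trans (×-homo-+ 1# (m ℕ.* m′) (n ℕ.* n′))
      (+-cong (×1-homo-* m m′) (×1-homo-* n n′))

    -x*-y≈x*y : ∀ x y → - x * - y ≈ x * y
    -x*-y≈x*y x y = trans (sym (-‿distribˡ-* x (- y)))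
      (trans (-‿cong (sym (-‿distribʳ-* x y))) (-‿involutive _))

    +-homo : ∀ u v → ⟦ RawRing._+_ Coeff u v ⟧ᶜ ≈ ⟦ u ⟧ᶜ + ⟦ v ⟧ᶜ
    +-homo (m , n) (m′ , n′) = begin
      ι (m ℕ.+ m′) - ι (n ℕ.+ n′)
        ≈⟨ +-cong (×-homo-+ 1# m m′) (-‿cong (×-homo-+ 1# n n′)) ⟩
      ι m + ι m′ - (ι n + ι n′)
        ≈⟨ +-congˡ (sym (⁻¹-∙-comm _ _)) ⟩
      ι m + ι m′ + (- ι n + - ι n′)
        ≈⟨ NS.solve 4 (λ a b c d → (a NS.:+ b) NS.:+ (c NS.:+ d) NS.:= (a NS.:+ c) NS.:+ (b NS.:+ d))
             refl _ _ _ _ ⟩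
      ι m - ι n + (ι m′ - ι n′) ∎

    *-homo : ∀ u v → ⟦ RawRing._*_ Coeff u v ⟧ᶜ ≈ ⟦ u ⟧ᶜ * ⟦ v ⟧ᶜ
    *-homo (m , n) (m′ , n′) = begin
      ι (m ℕ.* m′ ℕ.+ n ℕ.* n′) - ι (m ℕ.* n′ ℕ.+ n ℕ.* m′)
        ≈⟨ +-cong (ι-+* m n m′ n′) (-‿cong (ι-+* m n n′ m′)) ⟩
      ι m * ι m′ + ι n * ι n′ - (ι m * ι n′ + ι n * ι m′)
        ≈⟨ +-congˡ (sym (⁻¹-∙-comm _ _)) ⟩
      ι m * ι m′ + ι n * ι n′ + (- (ι m * ι n′) + - (ι n * ι m′))
        ≈⟨ +-cong (+-congˡ (sym (-x*-y≈x*y _ _))) (+-cong (-‿distribʳ-* _ _) (-‿distribˡ-* _ _)) ⟩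
      ι m * ι m′ + - ι n * - ι n′ + (ι m * - ι n′ + - ι n * ι m′)
        ≈⟨ NS.solve 4 (λ a b c d →
             (a NS.:* b NS.:+ c NS.:* d) NS.:+ (a NS.:* d NS.:+ c NS.:* b)
             NS.:= (a NS.:+ c) NS.:* (b NS.:+ d)) refl _ _ _ _ ⟩
      (ι m - ι n) * (ι m′ - ι n′) ∎

    -‿homo : ∀ u → ⟦ RawRing.-_ Coeff u ⟧ᶜ ≈ - ⟦ u ⟧ᶜ
    -‿homo (m , n) = sym (begin
      - (ι m - ι n)       ≈⟨ sym (⁻¹-∙-comm _ _) ⟩
      - ι m + - - ι n     ≈⟨ +-congˡ (-‿involutive _) ⟩
      - ι m + ι n         ≈⟨ +-comm _ _ ⟩
      ι n - ι m           ∎)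

    morphism : Coeff -Raw-AlmostCommutative⟶ fromCommutativeRing R
    morphism = record
      { ⟦_⟧ = ⟦_⟧ᶜ
      ; +-homo = +-homo
      ; *-homo = *-homo
      ; -‿homo = -‿homo
      ; 0-homo = -‿inverseʳ 0#
      ; 1-homo = trans (+-congˡ -0#≈0#) (trans (+-identityʳ _) (+-identityʳ 1#))
      }

    -- The hypothesis is an equation between natural number sums, so `ι n′ - ι n′` is inserted first
    -- to make `m ℕ.+ n′` appear.
    ⟦⟧ᶜ-cong : ∀ m n m′ n′ → m ℕ.+ n′ ≡ m′ ℕ.+ n → ι m - ι n ≈ ι m′ - ι n′
    ⟦⟧ᶜ-cong m n m′ n′ eq = begin
      ι m - ι n                        ≈⟨ +-congʳ (sym (trans (+-congˡ (-‿inverseʳ (ι n′))) (+-identityʳ _))) ⟩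
      ι m + (ι n′ - ι n′) - ι n        ≈⟨ +-congʳ (sym (+-assoc _ _ _)) ⟩
      ι m + ι n′ - ι n′ - ι n          ≈⟨ +-congʳ (+-congʳ (sym (×-homo-+ 1# m n′))) ⟩
      ι (m ℕ.+ n′) - ι n′ - ι n        ≈⟨ +-congʳ (+-congʳ (×-congˡ eq)) ⟩
      ι (m′ ℕ.+ n) - ι n′ - ι n        ≈⟨ +-congʳ (+-congʳ (×-homo-+ 1# m′ n)) ⟩
      ι m′ + ι n - ι n′ - ι n
        ≈⟨ NS.solve 4 (λ a b c d → ((a NS.:+ b) NS.:+ c) NS.:+ d NS.:= (a NS.:+ c) NS.:+ (b NS.:+ d))
             refl _ _ _ _ ⟩
      ι m′ - ι n′ + (ι n - ι n)        ≈⟨ +-congˡ (-‿inverseʳ _) ⟩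
      ι m′ - ι n′ + 0#                 ≈⟨ +-identityʳ _ ⟩
      ι m′ - ι n′                      ∎

    _coeff≟_ : ∀ u v → Maybe (⟦ u ⟧ᶜ ≈ ⟦ v ⟧ᶜ)
    (m , n) coeff≟ (m′ , n′) with m ℕ.+ n′ ℕ.≟ m′ ℕ.+ n
    ... | yes eq = just (⟦⟧ᶜ-cong m n m′ n′ eq)
    ... | no _   = nothing

  open Algebra.Solver.Ring Coeff (fromCommutativeRing R) morphism _coeff≟_ public
    using (solve; _:=_; _:+_; _:*_; _:-_; :-_; _:^_)

-- Order, squares and the exponential in the constructive reals

module RealProperties {r ℓ₁ ℓ₂} (R : RealNumbers r ℓ₁ ℓ₂) where
  open Reals R public
  open CommutativeRing commutativeRing public
    using (+-cong; +-congʳ; *-cong; *-congˡ; +-assoc; *-assoc; +-comm;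
           *-identityˡ; *-identityʳ; distribˡ; distribʳ; zeroˡ; zeroʳ; +-commutativeMonoid)
  open RingSolver commutativeRing public

  private variable
    w x y z : ℝ

  <-respʳ-≈ : x ≈ y → z < x → z < y
  <-respʳ-≈ = proj₁ <-resp-≈

  <-respˡ-≈ : x ≈ y → x < z → y < z
  <-respˡ-≈ = proj₂ <-resp-≈

  <⇒≤ : x < y → x ≤ y
  <⇒≤ x<y y<x = <-irrefl refl (<-trans x<y y<x)

  ≤-reflexive : x ≈ y → x ≤ y
  ≤-reflexive x≈y = <-irrefl (sym x≈y)

  ≤-refl : x ≤ x
  ≤-refl = ≤-reflexive refl

  ≤-trans : x ≤ y → y ≤ z → x ≤ z
  ≤-trans x≤y y≤z z<x = y≤z (<-≤-trans z<x x≤y)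

  -- In place of trichotomy, cotransitivity sets x apart from y or from z; each outcome either
  -- yields x < z or contradicts x ≤ y.
  ≤-<-trans : x ≤ y → y < z → x < z
  ≤-<-trans {x} {y} {z} x≤y y<z with #-cotrans (inj₁ y<z) x
  ... | inj₁ (inj₁ y<x) = contradiction y<x x≤y
  ... | inj₁ (inj₂ x<y) = <-trans x<y y<z
  ... | inj₂ (inj₁ x<z) = x<z
  ... | inj₂ (inj₂ z<x) = contradiction (<-trans y<z z<x) x≤y

  ≤-antisym : x ≤ y → y ≤ x → x ≈ y
  ≤-antisym {x} {y} x≤y y≤x = proj₁ (tight x y) λ { (inj₁ x<y) → y≤x x<y ; (inj₂ y<x) → x≤y y<x }

  ≤-poset : Poset r ℓ₁ ℓ₂
  ≤-poset = record
    { _≈_ = _≈_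
    ; _≤_ = _≤_
    ; isPartialOrder = record
      { isPreorder = record
        { isEquivalence = CommutativeRing.isEquivalence commutativeRing
        ; reflexive = ≤-reflexive
        ; trans = ≤-trans
        }
      ; antisym = ≤-antisym
      }
    }

  module ≤-Reasoning = Relation.Binary.Reasoning.PartialOrder ≤-poset

  -- Since x ≤ y is a negation, it may be proved by cases on any proposition.
  ≤-cases : ∀ {p} (P : Set p) → (P → x ≤ y) → (¬ P → x ≤ y) → x ≤ y
  ≤-cases P f g y<x = g (λ p → f p y<x) y<x

  ≈-cases : ∀ {p} (P : Set p) → (P → x ≈ y) → (¬ P → x ≈ y) → x ≈ y
  ≈-cases P f g = ≤-antisym
    (≤-cases P (λ p → ≤-reflexive (f p)) (λ ¬p → ≤-reflexive (g ¬p)))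
    (≤-cases P (λ p → ≤-reflexive (sym (f p))) (λ ¬p → ≤-reflexive (sym (g ¬p))))

  +-cancelʳ-< : ∀ z → x + z < y + z → x < y
  +-cancelʳ-< {x} {y} z p =
    <-respˡ-≈ (lem x) (<-respʳ-≈ (lem y) (+-monoˡ-< (- z) p))
    where
    lem : ∀ x → x + z + - z ≈ x
    lem x = trans (+-assoc _ _ _) (trans (+-congˡ (-‿inverseʳ z)) (+-identityʳ x))

  +-monoˡ-≤ : ∀ z → x ≤ y → x + z ≤ y + z
  +-monoˡ-≤ z x≤y p = x≤y (+-cancelʳ-< z p)

  +-mono-≤ : w ≤ x → y ≤ z → w + y ≤ x + z
  +-mono-≤ {w} {x} {y} {z} w≤x y≤z = begin
    w + y  ≤⟨ +-monoˡ-≤ y w≤x ⟩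
    x + y  ≈⟨ +-comm x y ⟩
    y + x  ≤⟨ +-monoˡ-≤ x y≤z ⟩
    z + x  ≈⟨ +-comm z x ⟩
    x + z  ∎
    where open ≤-Reasoning

  +-nonneg : 0# ≤ x → 0# ≤ y → 0# ≤ x + y
  +-nonneg {x} {y} 0≤x 0≤y = ≤-trans (≤-reflexive (sym (+-identityˡ 0#))) (+-mono-≤ 0≤x 0≤y)

  x≤x+y : 0# ≤ y → x ≤ x + y
  x≤x+y {y} {x} 0≤y = ≤-trans (≤-reflexive (sym (+-identityʳ x))) (+-mono-≤ ≤-refl 0≤y)

  x≤y+x : 0# ≤ y → x ≤ y + x
  x≤y+x {y} {x} 0≤y = ≤-trans (x≤x+y 0≤y) (≤-reflexive (+-comm x y))

  0≤y-x⇒x≤y : 0# ≤ y - x → x ≤ y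
  0≤y-x⇒x≤y {y} {x} p = ≤-trans (x≤x+y p)
    (≤-reflexive (solve 2 (λ x y → x :+ (y :- x) := y) refl x y))

  x≤y⇒0≤y-x : x ≤ y → 0# ≤ y - x
  x≤y⇒0≤y-x {x} {y} x≤y = ≤-trans (≤-reflexive (sym (-‿inverseʳ x))) (+-monoˡ-≤ (- x) x≤y)

  -- The axiom `*-pos` handles strict signs only; if 0 < x fails, then x is zero by antisymmetry,
  -- and likewise for y.
  *-nonneg : 0# ≤ x → 0# ≤ y → 0# ≤ x * y
  *-nonneg {x} {y} 0≤x 0≤y =
    ≤-cases (0# < x)
      (λ 0<x → ≤-cases (0# < y) (λ 0<y → <⇒≤ (*-pos 0<x 0<y))
        (λ y≤0 → ≤-reflexive (sym (trans (*-congˡ (≤-antisym y≤0 0≤y)) (zeroʳ x)))))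
      (λ x≤0 → ≤-reflexive (sym (trans (*-congʳ (≤-antisym x≤0 0≤x)) (zeroˡ y))))

  *-monoˡ-≤ : 0# ≤ z → x ≤ y → z * x ≤ z * y
  *-monoˡ-≤ {z} {x} {y} 0≤z x≤y = 0≤y-x⇒x≤y (≤-trans (*-nonneg 0≤z (x≤y⇒0≤y-x x≤y))
    (≤-reflexive (solve 3 (λ x y z → z :* (y :- x) := z :* y :- z :* x) refl x y z)))

  *-mono-≤ : 0# ≤ w → 0# ≤ z → w ≤ x → y ≤ z → w * y ≤ x * z
  *-mono-≤ {w} {z} {x} {y} 0≤w 0≤z w≤x y≤z = begin
    w * y  ≤⟨ *-monoˡ-≤ 0≤w y≤z ⟩
    w * z  ≈⟨ *-comm w z ⟩
    z * w  ≤⟨ *-monoˡ-≤ 0≤z w≤x ⟩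
    z * x  ≈⟨ *-comm z x ⟩
    x * z  ∎
    where open ≤-Reasoning

  *-monoˡ-< : 0# < z → x < y → z * x < z * y
  *-monoˡ-< {z} {x} {y} 0<z x<y =
    <-respˡ-≈ (+-identityˡ _) (<-respʳ-≈ lem (+-monoˡ-< (z * x) (*-pos 0<z 0<y-x)))
    where
    0<y-x : 0# < y - x
    0<y-x = <-respˡ-≈ (-‿inverseʳ x) (+-monoˡ-< (- x) x<y)
    lem : z * (y - x) + z * x ≈ z * y
    lem = solve 3 (λ x y z → z :* (y :- x) :+ z :* x := z :* y) refl x y z

  *-cancelˡ-≤ : 0# < z → z * x ≤ z * y → x ≤ y
  *-cancelˡ-≤ 0<z p y<x = p (*-monoˡ-< 0<z y<x)

  *-cancelˡ-≈ : 0# < z → z * x ≈ z * y → x ≈ y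
  *-cancelˡ-≈ 0<z p = ≤-antisym (*-cancelˡ-≤ 0<z (≤-reflexive p)) (*-cancelˡ-≤ 0<z (≤-reflexive (sym p)))

  square-nonneg : ∀ x → 0# ≤ x * x
  square-nonneg x = ≤-cases (x < 0#)
    (λ x<0 → let 0≤-x = ≤-trans (x≤y⇒0≤y-x (<⇒≤ x<0)) (≤-reflexive (+-identityˡ (- x))) in
      ≤-trans (*-nonneg 0≤-x 0≤-x)
        (≤-reflexive (solve 1 (λ x → (:- x) :* (:- x) := x :* x) refl x)))
    (λ 0≤x → *-nonneg 0≤x 0≤x)

  2xy≤x²+y² : ∀ x y → x * y + x * y ≤ x * x + y * y
  2xy≤x²+y² x y = 0≤y-x⇒x≤y (≤-trans (square-nonneg (x - y)) (≤-reflexive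
    (solve 2 (λ x y → (x :- y) :* (x :- y) := x :* x :+ y :* y :- (x :* y :+ x :* y)) refl x y)))

  -- Stands in for a square root: the final estimate bounds T² by the square of a nonnegative
  -- number, and this recovers T.
  *-cancel-square-≤ : 0# ≤ y → x * x ≤ y * y → x ≤ y
  *-cancel-square-≤ {y} {x} 0≤y p y<x = p (≤-<-trans
    (≤-trans (*-monoˡ-≤ 0≤y (<⇒≤ y<x)) (≤-reflexive (*-comm y x)))
    (*-monoˡ-< (≤-<-trans 0≤y y<x) y<x))

  -- A nonzero real need not be invertible here, so both signs are refuted instead: a strictly
  -- positive or strictly negative x has a positive square.
  square≈0⇒≈0 : x * x ≈ 0# → x ≈ 0#
  square≈0⇒≈0 {x} p = ≈-cases (0# < x)
    (λ 0<x → *-cancelˡ-≈ 0<x (trans p (sym (zeroʳ x))))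
    (λ x≤0 → ≤-antisym x≤0 (λ x<0 →
       <-irrefl (sym p) (<-respʳ-≈ (solve 1 (λ x → (:- x) :* (:- x) := x :* x) refl x)
         (*-pos (0<-x x<0) (0<-x x<0)))))
    where
    0<-x : x < 0# → 0# < - x
    0<-x x<0 = <-respˡ-≈ (-‿inverseʳ x) (<-respʳ-≈ (+-identityˡ (- x)) (+-monoˡ-< (- x) x<0))

  ^-nonneg : ∀ n → 0# ≤ x → 0# ≤ x ^ n
  ^-nonneg zero 0≤x = <⇒≤ 0<1
  ^-nonneg (suc n) 0≤x = *-nonneg 0≤x (^-nonneg n 0≤x)

  ^-mono-≤ : ∀ n → 0# ≤ x → x ≤ y → x ^ n ≤ y ^ n
  ^-mono-≤ zero 0≤x x≤y = ≤-refl
  ^-mono-≤ (suc n) 0≤x x≤y = *-mono-≤ 0≤x (^-nonneg n (≤-trans 0≤x x≤y)) x≤y (^-mono-≤ n 0≤x x≤y)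

  ^-pos : ∀ n → 0# < x → 0# < x ^ n
  ^-pos zero 0<x = 0<1
  ^-pos (suc n) 0<x = *-pos 0<x (^-pos n 0<x)

  fromℕ-nonneg : ∀ n → 0# ≤ fromℕ n
  fromℕ-nonneg zero = ≤-refl
  fromℕ-nonneg (suc n) = <⇒≤ (fromℕ-pos (suc n))

  +-pos-nonneg : 0# < x → 0# ≤ y → 0# < x + y
  +-pos-nonneg 0<x 0≤y = <-≤-trans 0<x (x≤x+y 0≤y)

  exp-0 : exp 0# ≈ 1#
  exp-0 = *-cancelˡ-≈ (exp-pos 0#) (trans (sym (exp-+ 0# 0#))
    (trans (exp-cong (+-identityˡ 0#)) (sym (*-identityʳ _))))

  exp-fromℕ-* : ∀ n x → exp (fromℕ n * x) ≈ exp x ^ n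
  exp-fromℕ-* zero x = trans (exp-cong (zeroˡ x)) exp-0
  exp-fromℕ-* (suc n) x = begin-equality
    exp ((1# + fromℕ n) * x)        ≈⟨ exp-cong (trans (distribʳ _ _ _) (+-congʳ (*-identityˡ x))) ⟩
    exp (x + fromℕ n * x)           ≈⟨ exp-+ _ _ ⟩
    exp x * exp (fromℕ n * x)       ≈⟨ *-congˡ (exp-fromℕ-* n x) ⟩
    exp x * exp x ^ n               ∎
    where open ≤-Reasoning

  exp-mono-≤ : x ≤ y → exp x ≤ exp y
  exp-mono-≤ {x} {y} x≤y = ≤-cases (x < y) (λ x<y → <⇒≤ (exp-mono-< x<y))
    (λ y≤x → ≤-reflexive (exp-cong (≤-antisym x≤y y≤x)))

  exp-cancel-≤ : exp x ≤ exp y → x ≤ y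
  exp-cancel-≤ p y<x = p (exp-mono-< y<x)

-- Finite real sums, Cauchy-Schwarz and indicators

module Sums {r ℓ₁ ℓ₂} (R : RealNumbers r ℓ₁ ℓ₂) where
  open RealProperties R

  private variable
    ℓ p : Level
    A B : Set ℓ
    P : Set p

  ∑ : List A → (A → ℝ) → ℝ
  ∑ xs f = foldr (λ x t → f x + t) 0# xs

  infix 8 ∑
  syntax ∑ xs (λ x → e) = ∑[ x ∈ xs ] e

  ∑-cong : ∀ {f g : A → ℝ} → (∀ x → f x ≈ g x) → ∀ xs → ∑ xs f ≈ ∑ xs g
  ∑-cong f≈g [] = refl
  ∑-cong f≈g (x ∷ xs) = +-cong (f≈g x) (∑-cong f≈g xs)

  ∑-mono-All : ∀ {P : Pred A p} {f g : A → ℝ} → (∀ x → P x → f x ≤ g x) →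
               ∀ {xs} → All P xs → ∑ xs f ≤ ∑ xs g
  ∑-mono-All f≤g [] = ≤-refl
  ∑-mono-All f≤g (px ∷ pxs) = +-mono-≤ (f≤g _ px) (∑-mono-All f≤g pxs)

  ∑-mono : ∀ {f g : A → ℝ} → (∀ x → f x ≤ g x) → ∀ xs → ∑ xs f ≤ ∑ xs g
  ∑-mono f≤g [] = ≤-refl
  ∑-mono f≤g (x ∷ xs) = +-mono-≤ (f≤g x) (∑-mono f≤g xs)

  ∑-0 : ∀ (xs : List A) → ∑[ _ ∈ xs ] 0# ≈ 0#
  ∑-0 [] = refl
  ∑-0 (x ∷ xs) = trans (+-identityˡ _) (∑-0 xs)

  ∑-nonneg : ∀ {f : A → ℝ} → (∀ x → 0# ≤ f x) → ∀ xs → 0# ≤ ∑ xs f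
  ∑-nonneg 0≤f xs = ≤-trans (≤-reflexive (sym (∑-0 xs))) (∑-mono 0≤f xs)

  ∑-+ : ∀ (f g : A → ℝ) xs → ∑[ x ∈ xs ] (f x + g x) ≈ ∑ xs f + ∑ xs g
  ∑-+ f g [] = sym (+-identityˡ 0#)
  ∑-+ f g (x ∷ xs) = trans (+-congˡ (∑-+ f g xs))
    (solve 4 (λ a b c d → (a :+ b) :+ (c :+ d) := (a :+ c) :+ (b :+ d)) refl _ _ _ _)

  ∑-*ˡ : ∀ c (f : A → ℝ) xs → ∑[ x ∈ xs ] (c * f x) ≈ c * ∑ xs f
  ∑-*ˡ c f [] = sym (zeroʳ c)
  ∑-*ˡ c f (x ∷ xs) = trans (+-congˡ (∑-*ˡ c f xs)) (sym (distribˡ c _ _))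

  ∑-*ʳ : ∀ c (f : A → ℝ) xs → ∑[ x ∈ xs ] (f x * c) ≈ ∑ xs f * c
  ∑-*ʳ c f xs = trans (∑-cong (λ x → *-comm (f x) c) xs) (trans (∑-*ˡ c f xs) (*-comm c _))

  ∑-comm : ∀ (f : A → B → ℝ) xs ys →
           ∑[ x ∈ xs ] ∑[ y ∈ ys ] f x y ≈ ∑[ y ∈ ys ] ∑[ x ∈ xs ] f x y
  ∑-comm f [] ys = sym (∑-0 ys)
  ∑-comm f (x ∷ xs) ys = trans (+-congˡ (∑-comm f xs ys)) (sym (∑-+ (f x) _ ys))

  ∑-* : ∀ (f : A → ℝ) (g : B → ℝ) xs ys →
        ∑[ x ∈ xs ] ∑[ y ∈ ys ] (f x * g y) ≈ ∑ xs f * ∑ ys g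
  ∑-* f g xs ys = trans (∑-cong (λ x → ∑-*ˡ (f x) g ys) xs) (∑-*ʳ (∑ ys g) f xs)

  ∑-const : ∀ c (xs : List A) → ∑[ _ ∈ xs ] c ≈ fromℕ (length xs) * c
  ∑-const c [] = sym (zeroˡ c)
  ∑-const c (x ∷ xs) = trans (+-cong (sym (*-identityˡ c)) (∑-const c xs)) (sym (distribʳ c _ _))

  -- Cauchy-Schwarz against the constant function 1. In the induction the cross term 2 a S is spread
  -- over the tail, where each 2 a f(y) is at most a² + f(y)².
  ∑-cauchy-schwarz : ∀ (f : A → ℝ) xs →
    ∑ xs f * ∑ xs f ≤ fromℕ (length xs) * ∑[ x ∈ xs ] (f x * f x)
  ∑-cauchy-schwarz f [] = ≤-reflexive (sym (trans (zeroˡ 0#) (sym (zeroˡ 0#))))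
  ∑-cauchy-schwarz f (x ∷ xs) = begin
    (a + S) * (a + S)
      ≈⟨ solve 2 (λ a S → (a :+ S) :* (a :+ S) := a :* a :+ (a :* S :+ a :* S) :+ S :* S) refl a S ⟩
    a * a + (a * S + a * S) + S * S
      ≤⟨ +-mono-≤ (+-mono-≤ ≤-refl cross) (∑-cauchy-schwarz f xs) ⟩
    a * a + (m * (a * a) + Q) + m * Q
      ≈⟨ solve 3 (λ b m Q → b :+ (m :* b :+ Q) :+ m :* Q := (b :+ Q) :+ m :* (b :+ Q)) refl (a * a) m Q ⟩
    (a * a + Q) + m * (a * a + Q)
      ≈⟨ +-congʳ (sym (*-identityˡ _)) ⟩
    1# * (a * a + Q) + m * (a * a + Q)
      ≈⟨ sym (distribʳ _ 1# m) ⟩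
    (1# + m) * (a * a + Q) ∎
    where
    open ≤-Reasoning
    a = f x
    S = ∑ xs f
    m = fromℕ (length xs)
    Q = ∑[ y ∈ xs ] (f y * f y)
    cross : a * S + a * S ≤ m * (a * a) + Q
    cross = begin
      a * S + a * S
        ≈⟨ sym (trans (∑-+ _ _ xs) (+-cong (∑-*ˡ a f xs) (∑-*ˡ a f xs))) ⟩
      ∑[ y ∈ xs ] (a * f y + a * f y)   ≤⟨ ∑-mono (λ y → 2xy≤x²+y² a (f y)) xs ⟩
      ∑[ y ∈ xs ] (a * a + f y * f y)   ≈⟨ trans (∑-+ _ _ xs) (+-congʳ (∑-const _ xs)) ⟩
      m * (a * a) + Q                   ∎

  𝟙 : Dec P → ℝ
  𝟙 (yes _) = 1#
  𝟙 (no _)  = 0#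

  𝟙-nonneg : (P? : Dec P) → 0# ≤ 𝟙 P?
  𝟙-nonneg (yes _) = <⇒≤ 0<1
  𝟙-nonneg (no _)  = ≤-refl

  𝟙-true : P → (P? : Dec P) → 𝟙 P? ≈ 1#
  𝟙-true p (yes _) = refl
  𝟙-true p (no ¬p) = contradiction p ¬p

  𝟙-false : ¬ P → (P? : Dec P) → 𝟙 P? ≈ 0#
  𝟙-false ¬p (yes p) = contradiction p ¬p
  𝟙-false ¬p (no _)  = refl

  𝟙-idem : (P? : Dec P) → 𝟙 P? * 𝟙 P? ≈ 𝟙 P?
  𝟙-idem (yes _) = *-identityˡ 1#
  𝟙-idem (no _)  = zeroˡ 0#

  𝟙-*-≤ : ∀ (P? : Dec P) {x y} → 0# ≤ y → (P → x ≤ y) → 𝟙 P? * x ≤ y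
  𝟙-*-≤ (yes p) 0≤y x≤y = ≤-trans (≤-reflexive (*-identityˡ _)) (x≤y p)
  𝟙-*-≤ (no _) 0≤y x≤y = ≤-trans (≤-reflexive (zeroˡ _)) 0≤y

  ∑-𝟙-none : ∀ {P : Pred A p} (P? : ∀ x → Dec (P x)) {xs} →
             All (λ x → ¬ P x) xs → ∑[ x ∈ xs ] 𝟙 (P? x) ≈ 0#
  ∑-𝟙-none P? [] = refl
  ∑-𝟙-none P? (¬px ∷ ¬pxs) = trans (+-cong (𝟙-false ¬px (P? _)) (∑-𝟙-none P? ¬pxs)) (+-identityˡ 0#)

  -- Two hits would be related by ∼, which the list forbids; so after the first hit all remaining
  -- indicators vanish.
  ∑-𝟙-unique : ∀ {ℓ′} {_∼_ : Rel A ℓ′} {P : Pred A p} (P? : ∀ x → Dec (P x)) →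
               (∀ {x y} → P x → P y → x ∼ y) →
               ∀ {xs} → AllPairs (λ x y → ¬ (x ∼ y)) xs → ∑[ x ∈ xs ] 𝟙 (P? x) ≤ 1#
  ∑-𝟙-unique P? sub [] = <⇒≤ 0<1
  ∑-𝟙-unique P? sub {x ∷ xs} (x≁xs ∷ xs!) with P? x
  ... | yes px = ≤-reflexive (trans (+-congˡ (∑-𝟙-none P? (All.map (λ x≁y py → x≁y (sub px py)) x≁xs)))
                   (+-identityʳ 1#))
  ... | no _   = ≤-trans (≤-reflexive (+-identityˡ _)) (∑-𝟙-unique P? sub xs!)

  -- Turns membership into a lower bound for a sum: the witness alone contributes c, and no other
  -- term is negative.
  ≤∑-Any : ∀ {P : Pred A p} (P? : ∀ x → Dec (P x)) {f : A → ℝ} {c} →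
           (∀ x → 0# ≤ f x) → (∀ {x} → P x → c ≤ f x) →
           ∀ {xs} → Any P xs → c ≤ ∑[ x ∈ xs ] (𝟙 (P? x) * f x)
  ≤∑-Any P? {f} {c} 0≤f c≤f {x ∷ xs} (here px) = begin
    c                                             ≤⟨ c≤f px ⟩
    f x                                           ≈⟨ sym (*-identityˡ _) ⟩
    1# * f x                                      ≈⟨ *-congʳ (sym (𝟙-true px (P? x))) ⟩
    𝟙 (P? x) * f x
      ≤⟨ x≤x+y (∑-nonneg (λ y → *-nonneg (𝟙-nonneg (P? y)) (0≤f y)) xs) ⟩
    𝟙 (P? x) * f x + ∑[ y ∈ xs ] (𝟙 (P? y) * f y) ∎
    where open ≤-Reasoning
  ≤∑-Any P? 0≤f c≤f {x ∷ xs} (there any) =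
    ≤-trans (≤∑-Any P? 0≤f c≤f any) (x≤y+x (*-nonneg (𝟙-nonneg (P? x)) (0≤f x)))

-- Translation invariance of sums over the field

module FiniteFieldSums {f ℓ} (F : FiniteField f ℓ) {m ℓₘ} (M : CommutativeMonoid m ℓₘ) where
  open FiniteField F using (Carrier; _+_; -_; elements; enumeration; order)
  private module F = FiniteField F
  open CommutativeMonoid M using (_≈_; _∙_; ε)
  private module M = CommutativeMonoid M
  open Algebra.Properties.CommutativeMonoid.Sum M using (sum; sum-permute; sum-cong-≋)
  open Inverse enumeration using (to; from; to-cong; strictlyInverseˡ; strictlyInverseʳ)

  sumElements : (Carrier → M.Carrier) → M.Carrier
  sumElements h = foldr (λ x t → h x ∙ t) ε elements

  sumElements≡sum : ∀ h → sumElements h ≡ sum (h ∘ from)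
  sumElements≡sum h = go order id
    where
    -- The indexing map is generalised to g because `tabulate` composes it with `suc` at each step.
    go : ∀ n (g : Fin n → Fin order) →
         foldr (λ x t → h x ∙ t) ε (map from (tabulate g)) ≡ sum (h ∘ from ∘ g)
    go zero g = ≡.refl
    go (suc n) g = ≡.cong (h (from (g zero)) ∙_) (go n (g ∘ suc))

  -- Adding b permutes the indices, with inverse adding -b. The target is an arbitrary commutative
  -- monoid because the result serves both field-valued sums (the characteristic) and real-valued
  -- ones (the characters).
  sumElements-translate : ∀ h → (∀ {x y} → x F.≈ y → h x ≈ h y) → ∀ b →
                          sumElements (λ x → h (x + b)) ≈ sumElements h
  sumElements-translate h h-cong b = begin
    sumElements (λ x → h (x + b))            ≡⟨ sumElements≡sum (λ x → h (x + b)) ⟩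
    sum (λ i → h (from i + b))
      ≈⟨ sum-cong-≋ (λ i → h-cong (F.sym (strictlyInverseʳ (from i + b)))) ⟩
    sum (λ i → h (from (to (from i + b))))   ≈⟨ M.sym (sum-permute (h ∘ from) π) ⟩
    sum (h ∘ from)                           ≡⟨ ≡.sym (sumElements≡sum h) ⟩
    sumElements h                            ∎
    where
    open Relation.Binary.Reasoning.Setoid M.setoid
    shift : F.Carrier → Fin order → Fin order
    shift c i = to (from i + c)
    shift-inverse : ∀ c d → c + d F.≈ F.0# → ∀ i → shift d (shift c i) ≡ i
    shift-inverse c d c+d≈0 i = ≡.trans
      (to-cong (F.trans (F.+-congʳ (strictlyInverseʳ _))
        (F.trans (F.+-assoc _ _ _) (F.trans (F.+-congˡ c+d≈0) (F.+-identityʳ _)))))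
      (strictlyInverseˡ i)
    π = permutation (shift b) (shift (- b))
          (shift-inverse (- b) b (F.-‿inverseˡ b)) (shift-inverse b (- b) (F.-‿inverseʳ b))

odd⇒suc : ∀ {n} → 2 ∤ n → ∃[ k ] n ≡ 1 ℕ.+ k ℕ.* 2
odd⇒suc {n} 2∤n with n % 2 in eq | m%n<n n 2
... | 0           | _ = contradiction (m%n≡0⇒n∣m n 2 eq) 2∤n
... | 1           | _ = n / 2 , ≡.trans (m≡m%n+[m/n]*n n 2) (≡.cong (ℕ._+ n / 2 ℕ.* 2) eq)
... | suc (suc _) | ℕ.s≤s (ℕ.s≤s ())

-- Odd characteristic, square roots and the quadratic form

module FieldProperties {f ℓ} (F : FiniteField f ℓ) where
  open FiniteField F public hiding (zero)
  open Space F public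
  open RingSolver commutativeRing public
  open Inverse enumeration using (to; from; to-cong; strictlyInverseˡ; strictlyInverseʳ)
  open Algebra.Properties.AbelianGroup +-abelianGroup using (identityʳ-unique)
  open Algebra.Properties.Semiring.Mult semiring using (×-assocˡ; ×-congˡ; ×-congʳ)
    renaming (_×_ to _×#_)
  open Algebra.Properties.AbelianGroup +-abelianGroup public
    using () renaming (x∙y⁻¹≈ε⇒x≈y to x-y≈0⇒x≈y)

  length-elements : length elements ≡ order
  length-elements = ≡.trans (length-map from (allFin order)) (length-tabulate id)

  elements-unique : Unique.Unique setoid elements
  elements-unique = Unique.map⁺ (≡.setoid (Fin order)) setoid
    (λ {i} {j} eq → ≡.trans (≡.sym (strictlyInverseˡ i)) (≡.trans (to-cong eq) (strictlyInverseˡ j)))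
    (UniqueP.allFin⁺ order)

  ∈-elements : ∀ x → Any (x ≈_) elements
  ∈-elements x = Any.map⁺ (Any.map (λ { ≡.refl → sym (strictlyInverseʳ x) }) (∈-allFin (to x)))

  *-cancelˡ : ∀ {x y z} → x ≉ 0# → x * y ≈ x * z → y ≈ z
  *-cancelˡ {x} {y} {z} x≉0 xy≈xz with ≉0⇒inverse x x≉0
  ... | x⁻¹ , x⁻¹x≈1 , _ = begin
    y              ≈⟨ sym (lem y) ⟩
    x⁻¹ * (x * y)  ≈⟨ *-congˡ xy≈xz ⟩
    x⁻¹ * (x * z)  ≈⟨ lem z ⟩
    z              ∎
    where
    open Relation.Binary.Reasoning.Setoid setoid
    lem : ∀ y → x⁻¹ * (x * y) ≈ y
    lem y = trans (sym (*-assoc _ _ _)) (trans (*-congʳ x⁻¹x≈1) (*-identityˡ y))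

  *-≉0 : ∀ {x y} → x ≉ 0# → y ≉ 0# → x * y ≉ 0#
  *-≉0 {x} x≉0 y≉0 xy≈0 = y≉0 (*-cancelˡ x≉0 (trans xy≈0 (sym (zeroʳ x))))

  -- The elements sum to the same value when translated by 1, so order × 1 vanishes.
  order×1≈0 : order ×# 1# ≈ 0#
  order×1≈0 = identityʳ-unique (sumElements id) _ (trans (sym shifted) (sumElements-translate id id 1#))
    where
    open FiniteFieldSums F +-commutativeMonoid
    foldr-+1 : ∀ xs → foldr (λ x t → (x + 1#) + t) 0# xs ≈ foldr _+_ 0# xs + length xs ×# 1#
    foldr-+1 [] = sym (+-identityˡ 0#)
    foldr-+1 (x ∷ xs) = trans (+-congˡ (foldr-+1 xs))
      (solve 4 (λ a b c d → (a :+ b) :+ (c :+ d) := (a :+ c) :+ (b :+ d)) refl _ _ _ _)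
    shifted : sumElements (_+ 1#) ≈ sumElements id + order ×# 1#
    shifted = trans (foldr-+1 elements) (+-congˡ (×-congˡ length-elements))

  -- Writing q = 1 + 2k, the vanishing of 2 would make q × 1 equal to 1, whereas it equals 0.
  2≉0 : 2 ∤ order → 1# + 1# ≉ 0#
  2≉0 2∤q 2≈0 with odd⇒suc 2∤q
  ... | k , eq = 1≉0 (begin
    1#                          ≈⟨ sym (+-identityʳ 1#) ⟩
    1# + 0#                     ≈⟨ +-congˡ (sym (×#0 k)) ⟩
    1# + k ×# 0#                ≈⟨ +-congˡ (×-congʳ k (sym (trans (+-congˡ (+-identityʳ 1#)) 2≈0))) ⟩
    1# + k ×# (2 ×# 1#)         ≈⟨ +-congˡ (×-assocˡ 1# k 2) ⟩
    (1 ℕ.+ k ℕ.* 2) ×# 1#       ≡⟨ ≡.cong (_×# 1#) (≡.sym eq) ⟩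
    order ×# 1#                 ≈⟨ order×1≈0 ⟩
    0#                          ∎)
    where
    open Relation.Binary.Reasoning.Setoid setoid
    ×#0 : ∀ k → k ×# 0# ≈ 0#
    ×#0 zero = refl
    ×#0 (suc k) = trans (+-identityˡ _) (×#0 k)

  square-roots : ∀ {x y} → x * x ≈ y * y → x ≈ y ⊎ x ≈ - y
  square-roots {x} {y} x²≈y² with x ≟ y
  ... | yes x≈y = inj₁ x≈y
  ... | no x≉y = inj₂ (x-y≈0⇒x≈y x (- y) (*-cancelˡ (x≉y ∘ x-y≈0⇒x≈y x y) (begin
    (x - y) * (x - - y)  ≈⟨ solve 2 (λ x y → (x :- y) :* (x :- (:- y)) := x :* x :- y :* y) refl x y ⟩
    x * x - y * y        ≈⟨ +-congʳ x²≈y² ⟩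
    y * y - y * y        ≈⟨ -‿inverseʳ _ ⟩
    0#                   ≈⟨ sym (zeroʳ _) ⟩
    (x - y) * 0#         ∎)))
    where open Relation.Binary.Reasoning.Setoid setoid

  ∈-vectors : ∀ d (v : Vector Carrier d) → Any (v ≋_) (vectors d)
  ∈-vectors zero v = here λ ()
  ∈-vectors (suc d) v = Any.cartesianProductWith⁺ Vector._∷_
    (λ { p q zero → p ; p q (suc i) → q i }) (∈-elements (v zero)) (∈-vectors d (v ∘ suc))

  ∈-nonZeroVectors : ∀ {d} {v : Vector Carrier d} → ¬ (v ≋ 0ᵛ) → Any (v ≋_) (nonZeroVectors d)
  ∈-nonZeroVectors {d} {v} v≉0 = Membership.∈-filter⁺ (≋-setoid d) (λ x → ¬? (x ≋? 0ᵛ))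
    (λ x≋y x≉0 y≋0 → x≉0 (λ i → trans (x≋y i) (y≋0 i))) (∈-vectors d v) v≉0

  infixr 8 _·_
  _·_ : ∀ {d} → Carrier → Vector Carrier d → Vector Carrier d
  s · x = Vector.map (s *_) x

  ·-cancel : ∀ {d s} {x y : Vector Carrier d} → s ≉ 0# → s · x ≋ s · y → x ≋ y
  ·-cancel s≉0 eq i = *-cancelˡ s≉0 (eq i)

  ∙-cong : ∀ {d} {x x′ y y′ : Vector Carrier d} → x ≋ x′ → y ≋ y′ → x ∙ y ≈ x′ ∙ y′
  ∙-cong {zero} p q = refl
  ∙-cong {suc d} p q = +-cong (*-cong (p zero) (q zero)) (∙-cong (p ∘ suc) (q ∘ suc))

  ‖‖≈∙ : ∀ {d} (x : Vector Carrier d) → ‖ x ‖ ≈ x ∙ x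
  ‖‖≈∙ {zero} x = refl
  ‖‖≈∙ {suc d} x = +-cong (*-congˡ (*-identityʳ (x zero))) (‖‖≈∙ (x ∘ suc))

  ·-∙ : ∀ {d} s (x y : Vector Carrier d) → (s · x) ∙ y ≈ s * (x ∙ y)
  ·-∙ {zero} s x y = sym (zeroʳ s)
  ·-∙ {suc d} s x y = trans (+-cong (*-assoc _ _ _) (·-∙ s (x ∘ suc) (y ∘ suc))) (sym (distribˡ s _ _))

  ∙-comm : ∀ {d} (x y : Vector Carrier d) → x ∙ y ≈ y ∙ x
  ∙-comm {zero} x y = refl
  ∙-comm {suc d} x y = +-cong (*-comm _ _) (∙-comm (x ∘ suc) (y ∘ suc))

  ‖·‖ : ∀ {d} s (x : Vector Carrier d) → ‖ s · x ‖ ≈ s * s * ‖ x ‖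
  ‖·‖ s x = begin
    ‖ s · x ‖          ≈⟨ ‖‖≈∙ (s · x) ⟩
    (s · x) ∙ (s · x)  ≈⟨ ·-∙ s x (s · x) ⟩
    s * (x ∙ (s · x))  ≈⟨ *-congˡ (trans (∙-comm x (s · x)) (·-∙ s x x)) ⟩
    s * (s * (x ∙ x))  ≈⟨ sym (*-assoc _ _ _) ⟩
    s * s * (x ∙ x)    ≈⟨ *-congˡ (sym (‖‖≈∙ x)) ⟩
    s * s * ‖ x ‖      ∎
    where open Relation.Binary.Reasoning.Setoid setoid

  ‖‖-cong : ∀ {d} {x y : Vector Carrier d} → x ≋ y → ‖ x ‖ ≈ ‖ y ‖
  ‖‖-cong {x = x} {y} p = trans (‖‖≈∙ x) (trans (∙-cong p p) (sym (‖‖≈∙ y)))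

  ‖0‖ : ∀ d → ‖ 0ᵛ {d} ‖ ≈ 0#
  ‖0‖ zero = refl
  ‖0‖ (suc d) = trans (+-cong (zeroˡ _) (‖0‖ d)) (+-identityˡ 0#)

  -- The polarisation identity. Its cross term stays on the left, so that equal distances can be
  -- cancelled as a summand and then 2 as a factor.
  ‖-‖ : ∀ {d} (x y : Vector Carrier d) → ‖ x -ᵛ y ‖ + (1# + 1#) * (x ∙ y) ≈ ‖ x ‖ + ‖ y ‖
  ‖-‖ {zero} x y = +-congˡ (zeroʳ _)
  ‖-‖ {suc d} x y = begin
    ((a - b) ^ 2 + u) + (1# + 1#) * (a * b + v)
      ≈⟨ +-congˡ {x = (a - b) ^ 2 + u} (double (a * b + v)) ⟩
    ((a - b) ^ 2 + u) + ((a * b + v) + (a * b + v))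
      ≈⟨ solve 4 (λ a b u v → ((a :- b) :^ 2 :+ u) :+ ((a :* b :+ v) :+ (a :* b :+ v))
            := (a :^ 2 :+ b :^ 2) :+ (u :+ (v :+ v))) refl a b u v ⟩
    (a ^ 2 + b ^ 2) + (u + (v + v))
      ≈⟨ +-congˡ (trans (+-congˡ (sym (double v))) (‖-‖ (x ∘ suc) (y ∘ suc))) ⟩
    (a ^ 2 + b ^ 2) + (‖ x ∘ suc ‖ + ‖ y ∘ suc ‖)
      ≈⟨ solve 4 (λ a b c d → (a :+ b) :+ (c :+ d) := (a :+ c) :+ (b :+ d)) refl _ _ _ _ ⟩
    (a ^ 2 + ‖ x ∘ suc ‖) + (b ^ 2 + ‖ y ∘ suc ‖) ∎
    where
    open Algebra.Properties.Semiring.Exp semiring using (_^_)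
    open Relation.Binary.Reasoning.Setoid setoid
    a = x zero
    b = y zero
    u = ‖ (x ∘ suc) -ᵛ (y ∘ suc) ‖
    v = (x ∘ suc) ∙ (y ∘ suc)
    double : ∀ z → (1# + 1#) * z ≈ z + z
    double z = trans (distribʳ z 1# 1#) (+-cong (*-identityˡ z) (*-identityˡ z))

  ‖-‖-cancel : ∀ {d j} (x y z : Vector Carrier d) → 1# + 1# ≉ 0# → ‖ y ‖ ≈ j → ‖ z ‖ ≈ j →
               ‖ x -ᵛ y ‖ ≈ ‖ x -ᵛ z ‖ → x ∙ y ≈ x ∙ z
  ‖-‖-cancel x y z 2≉0 y∈S z∈S eq = *-cancelˡ 2≉0 (+-cancelˡ _ _ _ (begin
    ‖ x -ᵛ y ‖ + (1# + 1#) * (x ∙ y)  ≈⟨ ‖-‖ x y ⟩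
    ‖ x ‖ + ‖ y ‖                     ≈⟨ +-congˡ (trans y∈S (sym z∈S)) ⟩
    ‖ x ‖ + ‖ z ‖                     ≈⟨ sym (‖-‖ x z) ⟩
    ‖ x -ᵛ z ‖ + (1# + 1#) * (x ∙ z)  ≈⟨ +-congʳ (sym eq) ⟩
    ‖ x -ᵛ y ‖ + (1# + 1#) * (x ∙ z)  ∎))
    where
    open Relation.Binary.Reasoning.Setoid setoid
    open Algebra.Properties.AbelianGroup +-abelianGroup renaming (∙-cancelˡ to +-cancelˡ)

-- Counting scalars with a prescribed square

module FieldCounting {r ℓ₁ ℓ₂ f ℓ} (R : RealNumbers r ℓ₁ ℓ₂) (F : FiniteField f ℓ) where
  open RealProperties R
  open Sums R
  private module F = FieldProperties F
  open F using (_≟_; elements)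

  -- Either no s qualifies, or some b does; then j cancels from s² j = b² j and every solution is b
  -- or -b.
  ∑-square-roots : ∀ {j} → j F.≉ F.0# → ∀ t →
                   ∑[ s ∈ elements ] 𝟙 (t ≟ s F.* s F.* j) ≤ 1# + 1#
  ∑-square-roots {j} j≉0 t with any? (λ s → t ≟ s F.* s F.* j) elements
  ... | no ¬any = ≤-trans (≤-reflexive (∑-𝟙-none (λ s → t ≟ s F.* s F.* j) (¬Any⇒All¬ elements ¬any)))
                          (+-nonneg (<⇒≤ 0<1) (<⇒≤ 0<1))
  ... | yes any with Any.satisfied any
  ...   | b , t≈b²j = begin
    ∑[ s ∈ elements ] 𝟙 (t ≟ s F.* s F.* j)                      ≤⟨ ∑-mono bound elements ⟩
    ∑[ s ∈ elements ] (𝟙 (s ≟ b) + 𝟙 (s ≟ F.- b))                ≈⟨ ∑-+ _ _ elements ⟩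
    ∑[ s ∈ elements ] 𝟙 (s ≟ b) + ∑[ s ∈ elements ] 𝟙 (s ≟ F.- b)
      ≤⟨ +-mono-≤ (single b) (single (F.- b)) ⟩
    1# + 1#                                                      ∎
    where
    open ≤-Reasoning
    single : ∀ c → ∑[ s ∈ elements ] 𝟙 (s ≟ c) ≤ 1#
    single c = ∑-𝟙-unique (_≟ c) (λ p q → F.trans p (F.sym q)) F.elements-unique
    bound : ∀ s → 𝟙 (t ≟ s F.* s F.* j) ≤ 𝟙 (s ≟ b) + 𝟙 (s ≟ F.- b)
    bound s with t ≟ s F.* s F.* j
    ... | no _ = +-nonneg (𝟙-nonneg (s ≟ b)) (𝟙-nonneg (s ≟ F.- b))
    ... | yes t≈s²j with F.square-roots (F.*-cancelˡ j≉0 (F.trans (F.*-comm _ _)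
                           (F.trans (F.trans (F.sym t≈s²j) t≈b²j) (F.*-comm _ _))))
    ...   | inj₁ s≈b  = ≤-trans (≤-reflexive (sym (𝟙-true s≈b (s ≟ b)))) (x≤x+y (𝟙-nonneg (s ≟ F.- b)))
    ...   | inj₂ s≈-b = ≤-trans (≤-reflexive (sym (𝟙-true s≈-b (s ≟ F.- b)))) (x≤y+x (𝟙-nonneg (s ≟ b)))

-- Orthogonality of additive characters

module CharacterSums {r ℓ₁ ℓ₂ f ℓ} (R : RealNumbers r ℓ₁ ℓ₂) (F : FiniteField f ℓ)
  (ψ : Fourier.AdditiveCharacter R F) where
  open RealProperties R
  open Sums R
  open Complex R using (re; im; ∣_∣²)
  open Fourier R F using (Nontrivial; Ê; q⁻ᵈ)
  private module F = FieldProperties F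
  open F using (Carrier; _≟_; elements; order; _∙_; _·_; ‖_‖; _-ᵛ_; _≋_;
                nonZeroVectors; FiniteSubset; card; points)
  open Fourier.AdditiveCharacter ψ
  open IsMonoidHomomorphism χ-homo using (homo; ε-homo; ⟦⟧-cong)

  -- Named after the parts of a point on the unit circle: χ is multiplicative with modulus 1, so the
  -- usual addition formulas hold.
  cos sin : Carrier → ℝ
  cos a = re (χ a)
  sin a = im (χ a)

  cos-cong : ∀ {a b} → a F.≈ b → cos a ≈ cos b
  cos-cong = proj₁ ∘ ⟦⟧-cong

  sin-cong : ∀ {a b} → a F.≈ b → sin a ≈ sin b
  sin-cong = proj₂ ∘ ⟦⟧-cong

  cos²+sin²≈1 : ∀ a → cos a * cos a + sin a * sin a ≈ 1#
  cos²+sin²≈1 a = trans (sym (+-cong (*-congˡ (*-identityʳ _)) (*-congˡ (*-identityʳ _)))) (χ-circle a)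

  -- No conjugate is formed: χ a is factored as χ (a - b) χ b, and multiplying by the conjugate of χ
  -- b becomes an application of cos² + sin² = 1.
  cos-diff : ∀ a b → cos (a F.- b) ≈ cos a * cos b + sin a * sin b
  cos-diff a b = sym (begin-equality
    cos a * cos b + sin a * sin b
      ≈⟨ +-cong (*-congʳ (trans (cos-cong a≈) (proj₁ (homo _ _))))
               (*-congʳ (trans (sin-cong a≈) (proj₂ (homo _ _)))) ⟩
    (c * cos b - s * sin b) * cos b + (c * sin b + s * cos b) * sin b
      ≈⟨ solve 4 (λ c s x y → (c :* x :- s :* y) :* x :+ (c :* y :+ s :* x) :* y
            := c :* (x :* x :+ y :* y)) refl c s (cos b) (sin b) ⟩
    c * (cos b * cos b + sin b * sin b)
      ≈⟨ trans (*-congˡ (cos²+sin²≈1 b)) (*-identityʳ c) ⟩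
    c ∎)
    where
    open ≤-Reasoning
    c = cos (a F.- b)
    s = sin (a F.- b)
    a≈ : a F.≈ (a F.- b) F.+ b
    a≈ = F.solve 2 (λ a b → a F.:= (a F.:- b) F.:+ b) F.refl a b

  -- The only point of the unit circle with real part 1 is 1 itself, so nontriviality can be read
  -- off the cosine alone.
  χ≉1⇒cos≉1 : ∀ u → ¬ (cos u ≈ 1# × sin u ≈ 0#) → ¬ (cos u ≈ 1#)
  χ≉1⇒cos≉1 u χu≉1 cos≈1 = χu≉1 (cos≈1 , square≈0⇒≈0 (begin-equality
    sin u * sin u
      ≈⟨ solve 2 (λ c s → s :* s := (c :* c :+ s :* s) :- c :* c) refl (cos u) (sin u) ⟩
    (cos u * cos u + sin u * sin u) - cos u * cos u
      ≈⟨ +-cong (cos²+sin²≈1 u) (-‿cong (trans (*-cong cos≈1 cos≈1) (*-identityʳ 1#))) ⟩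
    1# - 1#  ≈⟨ -‿inverseʳ 1# ⟩
    0#       ∎))
    where open ≤-Reasoning

  ∑-elements-translate : ∀ h → (∀ {x y} → x F.≈ y → h x ≈ h y) → ∀ b →
                         ∑[ s ∈ elements ] h (s F.+ b) ≈ ∑ elements h
  ∑-elements-translate = FiniteFieldSums.sumElements-translate F +-commutativeMonoid

  -- Translating s multiplies the complex sum X + iY by χ u yet leaves it unchanged, so (χ u - 1)(X
  -- + iY) = 0. The rest isolates X using real operations.
  ∑-cos-nontrivial : Nontrivial ψ → ∀ {a} → a F.≉ F.0# → ∑[ s ∈ elements ] cos (s F.* a) ≈ 0#
  ∑-cos-nontrivial (u , χu≉1) {a} a≉0 with F.≉0⇒inverse a a≉0
  ... | a⁻¹ , a⁻¹a≈1 , _ = ≈-cases (0# < X * X)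
    -- Nontriviality merely denies cos u = 1, which does not make cos u - 1 invertible. So X² is
    -- cancelled, under the assumption that it is positive, and the contradiction leaves X² ≤ 0.
    (λ 0<X² → contradiction (*-cancelˡ-≈ 0<X² X²p≈X²1) (χ≉1⇒cos≉1 u χu≉1))
    (λ X²≤0 → square≈0⇒≈0 (≤-antisym X²≤0 (square-nonneg X)))
    where
    open ≤-Reasoning
    X Y p q : ℝ
    X = ∑[ s ∈ elements ] cos (s F.* a)
    Y = ∑[ s ∈ elements ] sin (s F.* a)
    p = cos u
    q = sin u
    b : Carrier
    -- The shift of s that adds exactly u to s a.
    b = u F.* a⁻¹
    shift : ∀ s → (s F.+ b) F.* a F.≈ s F.* a F.+ u
    shift s = F.trans (F.distribʳ a s b) (F.+-congˡ
      (F.trans (F.*-assoc u a⁻¹ a) (F.trans (F.*-congˡ a⁻¹a≈1) (F.*-identityʳ u))))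
    X≈ : X ≈ X * p - Y * q
    X≈ = begin-equality
      X
        ≈⟨ sym (∑-elements-translate (λ s → cos (s F.* a)) (cos-cong ∘ F.*-congʳ) b) ⟩
      ∑[ s ∈ elements ] cos ((s F.+ b) F.* a)
        ≈⟨ ∑-cong (λ s → trans (cos-cong (shift s)) (trans (proj₁ (homo _ _))
             (solve 4 (λ x y p q → x :* p :- y :* q := x :* p :+ y :* (:- q)) refl _ _ p q))) elements ⟩
      ∑[ s ∈ elements ] (cos (s F.* a) * p + sin (s F.* a) * - q)
        ≈⟨ trans (∑-+ _ _ elements) (+-cong (∑-*ʳ p _ elements) (∑-*ʳ (- q) _ elements)) ⟩
      X * p + Y * - q
        ≈⟨ solve 4 (λ x y p q → x :* p :+ y :* (:- q) := x :* p :- y :* q) refl X Y p q ⟩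
      X * p - Y * q ∎
    Y≈ : Y ≈ X * q + Y * p
    Y≈ = begin-equality
      Y
        ≈⟨ sym (∑-elements-translate (λ s → sin (s F.* a)) (sin-cong ∘ F.*-congʳ) b) ⟩
      ∑[ s ∈ elements ] sin ((s F.+ b) F.* a)
        ≈⟨ ∑-cong (λ s → trans (sin-cong (shift s)) (proj₂ (homo _ _))) elements ⟩
      ∑[ s ∈ elements ] (cos (s F.* a) * q + sin (s F.* a) * p)
        ≈⟨ trans (∑-+ _ _ elements) (+-cong (∑-*ʳ q _ elements) (∑-*ʳ p _ elements)) ⟩
      X * q + Y * p ∎
    -- The translate of the sum by −b instead of b, which multiplies it by the conjugate of χ u.
    X≈′ : X ≈ X * p + Y * q
    X≈′ = sym (begin-equality
      X * p + Y * q                                   ≈⟨ +-cong (*-congʳ X≈) (*-congʳ Y≈) ⟩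
      (X * p - Y * q) * p + (X * q + Y * p) * q
        ≈⟨ solve 4 (λ X Y p q → (X :* p :- Y :* q) :* p :+ (X :* q :+ Y :* p) :* q
             := X :* (p :* p :+ q :* q)) refl X Y p q ⟩
      X * (p * p + q * q)                             ≈⟨ *-congˡ (cos²+sin²≈1 u) ⟩
      X * 1#                                          ≈⟨ *-identityʳ X ⟩
      X                                               ∎)
    -- Adding the two expressions for X eliminates Y.
    2Xp≈2X : X * p + X * p ≈ X + X
    2Xp≈2X = trans
      (solve 4 (λ X Y p q → X :* p :+ X :* p := (X :* p :- Y :* q) :+ (X :* p :+ Y :* q)) refl X Y p q)
      (+-cong (sym X≈) (sym X≈′))
    X²p≈X²1 : X * X * p ≈ X * X * 1#
    X²p≈X²1 = *-cancelˡ-≈ (+-pos-nonneg 0<1 (<⇒≤ 0<1)) (begin-equality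
      (1# + 1#) * (X * X * p)   ≈⟨ double _ ⟩
      X * X * p + X * X * p
        ≈⟨ solve 2 (λ X p → X :* X :* p :+ X :* X :* p := X :* (X :* p :+ X :* p)) refl X p ⟩
      X * (X * p + X * p)       ≈⟨ *-congˡ 2Xp≈2X ⟩
      X * (X + X)               ≈⟨ distribˡ X X X ⟩
      X * X + X * X             ≈⟨ sym (double _) ⟩
      (1# + 1#) * (X * X)       ≈⟨ *-congˡ (sym (*-identityʳ _)) ⟩
      (1# + 1#) * (X * X * 1#)  ∎)
      where
      double : ∀ z → (1# + 1#) * z ≈ z + z
      double z = trans (distribʳ z 1# 1#) (+-cong (*-identityˡ z) (*-identityˡ z))

  ∑-cos-trivial : ∀ {a} → a F.≈ F.0# → ∑[ s ∈ elements ] cos (s F.* a) ≈ fromℕ order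
  ∑-cos-trivial {a} a≈0 = begin-equality
    ∑[ s ∈ elements ] cos (s F.* a)
      ≈⟨ ∑-cong (λ s → trans (cos-cong (F.trans (F.*-congˡ a≈0) (F.zeroʳ s))) (proj₁ ε-homo)) elements ⟩
    ∑[ s ∈ elements ] 1#            ≈⟨ trans (∑-const 1# elements) (*-identityʳ _) ⟩
    fromℕ (length elements)         ≡⟨ ≡.cong fromℕ F.length-elements ⟩
    fromℕ order                     ∎
    where open ≤-Reasoning

  -- Energy of the set and its isosceles triples

  module Energy {d} (E : FiniteSubset d) where
    private
      n : ℝ
      n = fromℕ (card E)
      q : ℝ
      q = fromℕ order

    cosSum sinSum : Vector Carrier d → ℝ
    cosSum x = ∑[ y ∈ points E ] cos (F.- (x ∙ y))
    sinSum x = ∑[ y ∈ points E ] sin (F.- (x ∙ y))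

    -- |q^d Ê(x)|²
    energy : Vector Carrier d → ℝ
    energy x = cosSum x * cosSum x + sinSum x * sinSum x

    energy-cong : ∀ {x y} → x ≋ y → energy x ≈ energy y
    energy-cong {x} {y} x≋y = +-cong (*-cong c c) (*-cong s s)
      where
      arg : ∀ z → F.- (x ∙ z) F.≈ F.- (y ∙ z)
      arg z = F.-‿cong (F.∙-cong x≋y (λ _ → F.refl))
      c : cosSum x ≈ cosSum y
      c = ∑-cong (λ z → cos-cong (arg z)) (points E)
      s : sinSum x ≈ sinSum y
      s = ∑-cong (λ z → sin-cong (arg z)) (points E)

    -- Phrased through orthogonality to every y because that is what s = 0 gives directly for s · x.
    energy-0 : ∀ x → (∀ y → x ∙ y F.≈ F.0#) → energy x ≈ n * n
    energy-0 x x∙y≈0 = trans (+-cong (*-cong c c) (*-cong s s))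
      (trans (+-congˡ (zeroˡ 0#)) (+-identityʳ _))
      where
      arg : ∀ y → F.- (x ∙ y) F.≈ F.0#
      arg y = F.trans (F.-‿cong (x∙y≈0 y)) -0≈0
        where
        -0≈0 : F.- F.0# F.≈ F.0#
        -0≈0 = F.trans (F.sym (F.+-identityˡ _)) (F.-‿inverseʳ F.0#)
      c : cosSum x ≈ n
      c = trans (∑-cong (λ y → trans (cos-cong (arg y)) (proj₁ ε-homo)) (points E))
            (trans (∑-const 1# (points E)) (*-identityʳ n))
      s : sinSum x ≈ 0#
      s = trans (∑-cong (λ y → trans (sin-cong (arg y)) (proj₂ ε-homo)) (points E)) (∑-0 (points E))

    ∣Ê∣²≈energy : ∀ x → ∣ Ê ψ E x ∣² ≈ q⁻ᵈ ψ E * q⁻ᵈ ψ E * energy x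
    ∣Ê∣²≈energy x = trans
      (+-cong (*-cong (*-congˡ (proj₁ (lem (points E)))) (*-congʳ (*-congˡ (proj₁ (lem (points E))))))
              (*-cong (*-congˡ (proj₂ (lem (points E)))) (*-congʳ (*-congˡ (proj₂ (lem (points E)))))))
      (trans (+-cong (*-congˡ (*-identityʳ _)) (*-congˡ (*-identityʳ _)))
        (solve 3 (λ w c s → (w :* c) :* (w :* c) :+ (w :* s) :* (w :* s)
          := w :* w :* (c :* c :+ s :* s)) refl _ _ _))
      where
      open Complex R using (_+ᶜ_; 0ᶜ)
      lem : ∀ ys → let z = foldr (λ y z → χ (F.- (x ∙ y)) +ᶜ z) 0ᶜ ys in
            re z ≈ ∑[ y ∈ ys ] cos (F.- (x ∙ y)) × im z ≈ ∑[ y ∈ ys ] sin (F.- (x ∙ y))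
      lem [] = refl , refl
      lem (y ∷ ys) = +-congˡ (proj₁ (lem ys)) , +-congˡ (proj₂ (lem ys))

    -- In the two double sums, the product of cosines and the product of sines for the same (y, z)
    -- merge by the difference formula.
    energy-expand : ∀ s x → energy (s · x) ≈
      ∑[ y ∈ points E ] ∑[ z ∈ points E ] cos (s F.* (x ∙ z F.- x ∙ y))
    energy-expand s x = begin-equality
      energy (s · x)
        ≈⟨ sym (+-cong (∑-* c c P P) (∑-* t t P P)) ⟩
      ∑[ y ∈ P ] ∑[ z ∈ P ] (c y * c z) + ∑[ y ∈ P ] ∑[ z ∈ P ] (t y * t z)
        ≈⟨ sym (trans (∑-cong (λ y → ∑-+ _ _ P) P) (∑-+ _ _ P)) ⟩
      ∑[ y ∈ P ] ∑[ z ∈ P ] (c y * c z + t y * t z)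
        ≈⟨ ∑-cong (λ y → ∑-cong (λ z → trans (sym (cos-diff _ _)) (cos-cong (arg y z))) P) P ⟩
      ∑[ y ∈ P ] ∑[ z ∈ P ] cos (s F.* (x ∙ z F.- x ∙ y)) ∎
      where
      open ≤-Reasoning
      P = points E
      c t : Vector Carrier d → ℝ
      c y = cos (F.- ((s · x) ∙ y))
      t y = sin (F.- ((s · x) ∙ y))
      arg : ∀ y z → F.- ((s · x) ∙ y) F.- F.- ((s · x) ∙ z) F.≈ s F.* (x ∙ z F.- x ∙ y)
      arg y z = F.trans
        (F.+-cong (F.-‿cong (F.·-∙ s x y)) (F.-‿cong (F.-‿cong (F.·-∙ s x z))))
        (F.solve 3 (λ s a b → F.:- (s F.:* a) F.:- (F.:- (s F.:* b)) F.:= s F.:* (b F.:- a)) F.refl s _ _)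

    -- The apex is x; degenerate triples with y = z are included, as they must be when squares of
    -- multiplicities are counted.
    triangles : ℝ
    triangles = ∑[ x ∈ points E ] ∑[ y ∈ points E ] ∑[ z ∈ points E ] 𝟙 (‖ x -ᵛ y ‖ ≟ ‖ x -ᵛ z ‖)

    module _ {j} (E⊆S : E F.⊆S j) (j≉0 : j F.≉ F.0#) where

      -- One direction of the equivalence is enough: equal distances force x ∙ y = x ∙ z, and the
      -- sum over s is q on such pairs and never negative, so any further pair could only enlarge
      -- the right side.
      order*triangles≤∑energy : F.1# F.+ F.1# F.≉ F.0# → Nontrivial ψ →
        q * triangles ≤ ∑[ x ∈ points E ] ∑[ s ∈ elements ] energy (s · x)
      order*triangles≤∑energy 2≉0 nontrivial = begin
        q * triangles
          ≈⟨ sym (trans (∑-cong (λ x → trans (∑-cong (λ y → ∑-*ˡ q _ P) P) (∑-*ˡ q _ P)) P) (∑-*ˡ q _ P)) ⟩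
        ∑[ x ∈ P ] ∑[ y ∈ P ] ∑[ z ∈ P ] (q * 𝟙 (‖ x -ᵛ y ‖ ≟ ‖ x -ᵛ z ‖))
          ≤⟨ ∑-mono (λ x → ∑-mono-All (λ y y∈S → ∑-mono-All (λ z z∈S → bound x y z y∈S z∈S) E⊆S) E⊆S) P ⟩
        ∑[ x ∈ P ] ∑[ y ∈ P ] ∑[ z ∈ P ] ∑[ s ∈ elements ] cos (s F.* (x ∙ z F.- x ∙ y))
          ≈⟨ ∑-cong (λ x → trans (∑-cong (λ y → ∑-comm _ P elements) P) (∑-comm _ P elements)) P ⟩
        ∑[ x ∈ P ] ∑[ s ∈ elements ] ∑[ y ∈ P ] ∑[ z ∈ P ] cos (s F.* (x ∙ z F.- x ∙ y))
          ≈⟨ sym (∑-cong (λ x → ∑-cong (λ s → energy-expand s x) elements) P) ⟩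
        ∑[ x ∈ P ] ∑[ s ∈ elements ] energy (s · x) ∎
        where
        open ≤-Reasoning
        P = points E
        bound : ∀ x y z → ‖ y ‖ F.≈ j → ‖ z ‖ F.≈ j → q * 𝟙 (‖ x -ᵛ y ‖ ≟ ‖ x -ᵛ z ‖) ≤
                ∑[ s ∈ elements ] cos (s F.* (x ∙ z F.- x ∙ y))
        bound x y z y∈S z∈S with ‖ x -ᵛ y ‖ ≟ ‖ x -ᵛ z ‖ | (x ∙ z F.- x ∙ y) ≟ F.0#
        ... | yes _  | yes a≈0 = ≤-reflexive (trans (*-identityʳ q) (sym (∑-cos-trivial a≈0)))
        ... | yes eq | no a≉0  = contradiction
          (F.trans (F.+-congʳ (F.sym (F.‖-‖-cancel x y z 2≉0 y∈S z∈S eq))) (F.-‿inverseʳ _)) a≉0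
        ... | no _   | yes a≈0 = ≤-trans (≤-reflexive (zeroʳ q))
                                   (≤-trans (fromℕ-nonneg order) (≤-reflexive (sym (∑-cos-trivial a≈0))))
        ... | no _   | no a≉0  = ≤-reflexive (trans (zeroʳ q) (sym (∑-cos-nontrivial nontrivial a≉0)))

      -- Weighted double counting: each summand is charged to the vector v = s · x, the sums are
      -- interchanged, and v is charged at most twice. It is applied with the squared energy as g.
      ∑-punctured-cones : ∀ (g : Vector Carrier d → ℝ) →
        (∀ x → 0# ≤ g x) → (∀ {x y} → x ≋ y → g x ≈ g y) →
        ∑[ x ∈ points E ] ∑[ s ∈ elements ] (𝟙 (¬? (s ≟ F.0#)) * g (s · x)) ≤
        (1# + 1#) * ∑ (nonZeroVectors d) g
      ∑-punctured-cones g 0≤g g-cong = begin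
        ∑[ x ∈ P ] ∑[ s ∈ elements ] (𝟙 (¬? (s ≟ F.0#)) * g (s · x))
          ≤⟨ ∑-mono-All (λ x x∈S → ∑-mono (λ s → spread x x∈S s) elements) E⊆S ⟩
        ∑[ x ∈ P ] ∑[ s ∈ elements ] ∑[ v ∈ V ] (𝟙 (hit? v s x) * g v)
          ≈⟨ trans (∑-cong (λ x → ∑-comm _ elements V) P) (∑-comm _ P V) ⟩
        ∑[ v ∈ V ] ∑[ x ∈ P ] ∑[ s ∈ elements ] (𝟙 (hit? v s x) * g v)
          ≈⟨ ∑-cong (λ v → trans (∑-comm _ P elements)
               (trans (∑-cong (λ s → ∑-*ʳ (g v) _ P) elements) (∑-*ʳ (g v) _ elements))) V ⟩
        ∑[ v ∈ V ] (∑[ s ∈ elements ] ∑[ x ∈ P ] 𝟙 (hit? v s x) * g v)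
          ≤⟨ ∑-mono (λ v → *-mono-≤ (∑-nonneg (λ s → ∑-nonneg (λ x → 𝟙-nonneg (hit? v s x)) P) elements)
               (0≤g v) (fibre v) ≤-refl) V ⟩
        ∑[ v ∈ V ] ((1# + 1#) * g v)
          ≈⟨ ∑-*ˡ (1# + 1#) g V ⟩
        (1# + 1#) * ∑ V g ∎
        where
        open ≤-Reasoning
        P = points E
        V = nonZeroVectors d
        hit? : ∀ v s x → Dec (s F.≉ F.0# × v ≋ s · x)
        hit? v s x = ¬? (s ≟ F.0#) ×-dec (v F.≋? (s · x))
        -- This is where j ≠ 0 keeps s · x among the nonzero vectors: its norm s² j is nonzero.
        spread : ∀ x → ‖ x ‖ F.≈ j → ∀ s →
          𝟙 (¬? (s ≟ F.0#)) * g (s · x) ≤ ∑[ v ∈ V ] (𝟙 (hit? v s x) * g v)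
        spread x x∈S s = 𝟙-*-≤ (¬? (s ≟ F.0#))
          (∑-nonneg (λ v → *-nonneg (𝟙-nonneg (hit? v s x)) (0≤g v)) V)
          (λ s≉0 → ≤∑-Any (λ v → hit? v s x) 0≤g (λ (_ , v≋sx) → ≤-reflexive (sym (g-cong v≋sx)))
            (Any.map (λ sx≋v → s≉0 , λ i → F.sym (sx≋v i)) (F.∈-nonZeroVectors (λ sx≋0 →
              F.*-≉0 (F.*-≉0 s≉0 s≉0) j≉0 (F.trans (F.*-congˡ (F.sym x∈S))
                (F.trans (F.sym (F.‖·‖ s x)) (F.trans (F.‖‖-cong sx≋0) (F.‖0‖ d))))))))
        -- For fixed s ≠ 0 scaling is injective and E lists no point twice, so at most one x hits v;
        -- comparing norms rules out all other s.
        fibre-s : ∀ v s → ∑[ x ∈ P ] 𝟙 (hit? v s x) ≤ 𝟙 (‖ v ‖ ≟ s F.* s F.* j)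
        fibre-s v s with ‖ v ‖ ≟ s F.* s F.* j
        ... | no ‖v‖≉ = ≤-reflexive (∑-𝟙-none (hit? v s) (All.map (λ {x} x∈S (_ , v≋sx) →
          ‖v‖≉ (F.trans (F.‖‖-cong v≋sx) (F.trans (F.‖·‖ s x) (F.*-congˡ x∈S)))) E⊆S))
        ... | yes _ = ∑-𝟙-unique (hit? v s) (λ (s≉0 , v≋sx) (_ , v≋sy) →
          F.·-cancel s≉0 (λ i → F.trans (F.sym (v≋sx i)) (v≋sy i))) (F.unique E)
        fibre : ∀ v → ∑[ s ∈ elements ] ∑[ x ∈ P ] 𝟙 (hit? v s x) ≤ 1# + 1#
        fibre v = ≤-trans (∑-mono (fibre-s v) elements) (FieldCounting.∑-square-roots R F j≉0 ‖ v ‖)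

      -- The T of the overview; an indicator removes s = 0, so that this sum and the full one run
      -- over the same list.
      punctured : ℝ
      punctured = ∑[ x ∈ points E ] ∑[ s ∈ elements ] (𝟙 (¬? (s ≟ F.0#)) * energy (s · x))

      -- At s = 0 all character values are 1 and the energy is |E|²; since 0 is listed only once,
      -- this contributes at most |E|² for each x.
      ∑energy≤card³+punctured :
        ∑[ x ∈ points E ] ∑[ s ∈ elements ] energy (s · x) ≤ n * (n * n) + punctured
      ∑energy≤card³+punctured = begin
        ∑[ x ∈ P ] ∑[ s ∈ elements ] energy (s · x)
          ≤⟨ ∑-mono (λ x → ∑-mono (split x) elements) P ⟩
        ∑[ x ∈ P ] ∑[ s ∈ elements ] (𝟙 (s ≟ F.0#) * (n * n) + 𝟙 (¬? (s ≟ F.0#)) * energy (s · x))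
          ≈⟨ trans (∑-cong (λ x → ∑-+ _ _ elements) P) (∑-+ _ _ P) ⟩
        ∑[ x ∈ P ] ∑[ s ∈ elements ] (𝟙 (s ≟ F.0#) * (n * n)) + punctured
          ≤⟨ +-monoˡ-≤ punctured (∑-mono (λ _ → origin) P) ⟩
        ∑[ x ∈ P ] (n * n) + punctured
          ≈⟨ +-congʳ (∑-const (n * n) P) ⟩
        n * (n * n) + punctured ∎
        where
        open ≤-Reasoning
        P = points E
        split : ∀ x s → energy (s · x) ≤ 𝟙 (s ≟ F.0#) * (n * n) + 𝟙 (¬? (s ≟ F.0#)) * energy (s · x)
        split x s with s ≟ F.0#
        ... | no _ = ≤-reflexive (sym (trans (+-cong (zeroˡ _) (*-identityˡ _)) (+-identityˡ _)))
        ... | yes s≈0 = ≤-reflexive (trans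
          (energy-0 (s · x) (λ y → F.trans (F.·-∙ s x y) (F.trans (F.*-congʳ s≈0) (F.zeroˡ _))))
          (sym (trans (+-cong (*-identityˡ _) (zeroˡ _)) (+-identityʳ _))))
        origin : ∑[ s ∈ elements ] (𝟙 (s ≟ F.0#) * (n * n)) ≤ n * n
        origin = begin
          ∑[ s ∈ elements ] (𝟙 (s ≟ F.0#) * (n * n))  ≈⟨ ∑-*ʳ (n * n) _ elements ⟩
          ∑[ s ∈ elements ] 𝟙 (s ≟ F.0#) * (n * n)
            ≤⟨ *-mono-≤ (∑-nonneg (λ s → 𝟙-nonneg (s ≟ F.0#)) elements) (square-nonneg n)
                 (∑-𝟙-unique (_≟ F.0#) (λ p q → F.trans p (F.sym q)) F.elements-unique) ≤-refl ⟩
          1# * (n * n)                                ≈⟨ *-identityˡ _ ⟩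
          n * n                                       ∎

      -- Cauchy-Schwarz is used over x and then over s, at the cost of the factors |E| and q; the
      -- indicator survives squaring because it is idempotent.
      punctured²≤ : punctured * punctured ≤
        n * (q * ((1# + 1#) * ∑[ x ∈ nonZeroVectors d ] (energy x * energy x)))
      punctured²≤ = begin
        punctured * punctured
          ≤⟨ ∑-cauchy-schwarz _ P ⟩
        n * ∑[ x ∈ P ] (∑ elements (a x) * ∑ elements (a x))
          ≤⟨ *-monoˡ-≤ (fromℕ-nonneg (card E)) (∑-mono (λ x → ∑-cauchy-schwarz (a x) elements) P) ⟩
        n * ∑[ x ∈ P ] (fromℕ (length elements) * ∑[ s ∈ elements ] (a x s * a x s))
          ≡⟨ ≡.cong (λ k → n * ∑[ x ∈ P ] (fromℕ k * ∑[ s ∈ elements ] (a x s * a x s)))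
               F.length-elements ⟩
        n * ∑[ x ∈ P ] (q * ∑[ s ∈ elements ] (a x s * a x s))
          ≈⟨ *-congˡ (∑-*ˡ q _ P) ⟩
        n * (q * ∑[ x ∈ P ] ∑[ s ∈ elements ] (a x s * a x s))
          ≈⟨ *-congˡ (*-congˡ (∑-cong (λ x → ∑-cong (λ s → square x s) elements) P)) ⟩
        n * (q * ∑[ x ∈ P ] ∑[ s ∈ elements ] (𝟙 (¬? (s ≟ F.0#)) * (energy (s · x) * energy (s · x))))
          ≤⟨ *-monoˡ-≤ (fromℕ-nonneg (card E)) (*-monoˡ-≤ (fromℕ-nonneg order)
               (∑-punctured-cones (λ x → energy x * energy x) (λ x → square-nonneg (energy x))
                 (λ x≋y → *-cong (energy-cong x≋y) (energy-cong x≋y)))) ⟩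
        n * (q * ((1# + 1#) * ∑[ x ∈ nonZeroVectors d ] (energy x * energy x))) ∎
        where
        open ≤-Reasoning
        P = points E
        a : Vector Carrier d → Carrier → ℝ
        a x s = 𝟙 (¬? (s ≟ F.0#)) * energy (s · x)
        square : ∀ x s → a x s * a x s ≈ 𝟙 (¬? (s ≟ F.0#)) * (energy (s · x) * energy (s · x))
        square x s = trans
          (solve 2 (λ i e → (i :* e) :* (i :* e) := (i :* i) :* (e :* e)) refl _ _)
          (*-congʳ (𝟙-idem (¬? (s ≟ F.0#))))

    -- For a fixed apex x let ν(t) count the points at distance t. Over Δ(E) the ν(t) add up to at
    -- least |E|, as every distance from x occurs there, while their squares add up to at most the
    -- number of pairs equidistant from x.
    card³≤∣Δ∣*triangles : n * (n * n) ≤ fromℕ (length (F.Δ E)) * triangles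
    card³≤∣Δ∣*triangles = begin
      n * (n * n)                              ≈⟨ sym (∑-const (n * n) P) ⟩
      ∑[ x ∈ P ] (n * n)                       ≤⟨ ∑-mono-All pinned (self) ⟩
      ∑[ x ∈ P ] (m * ∑[ y ∈ P ] ∑[ z ∈ P ] 𝟙 (‖ x -ᵛ y ‖ ≟ ‖ x -ᵛ z ‖)) ≈⟨ ∑-*ˡ m _ P ⟩
      m * triangles                            ∎
      where
      open ≤-Reasoning
      P = points E
      D = F.Δ E
      m = fromℕ (length D)
      -- Attaches to each point its own membership in E, from which membership of the distances in
      -- Δ(E) follows.
      self : All (λ x → Any (x ≋_) P) P
      self = All.tabulateₛ (F.≋-setoid d) id
      pinned : ∀ x → Any (x ≋_) P → n * n ≤ m * ∑[ y ∈ P ] ∑[ z ∈ P ] 𝟙 (‖ x -ᵛ y ‖ ≟ ‖ x -ᵛ z ‖)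
      pinned x x∈P = begin
        n * n
          ≤⟨ *-mono-≤ (fromℕ-nonneg (card E)) ∑ν-nonneg n≤∑ν n≤∑ν ⟩
        ∑ D ν * ∑ D ν
          ≤⟨ ∑-cauchy-schwarz ν D ⟩
        m * ∑[ t ∈ D ] (ν t * ν t)
          ≈⟨ *-congˡ (trans (∑-cong (λ t → sym (∑-* (at t) (at t) P P)) D)
               (trans (∑-comm _ D P) (∑-cong (λ y → ∑-comm _ D P) P))) ⟩
        m * ∑[ y ∈ P ] ∑[ z ∈ P ] ∑[ t ∈ D ] (at t y * at t z)
          ≤⟨ *-monoˡ-≤ (fromℕ-nonneg (length D)) (∑-mono (λ y → ∑-mono (λ z → collapse y z) P) P) ⟩
        m * ∑[ y ∈ P ] ∑[ z ∈ P ] 𝟙 (‖ x -ᵛ y ‖ ≟ ‖ x -ᵛ z ‖) ∎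
        where
        at : Carrier → Vector Carrier d → ℝ
        at t y = 𝟙 (‖ x -ᵛ y ‖ ≟ t)
        ν : Carrier → ℝ
        ν t = ∑[ y ∈ P ] at t y
        ∑ν-nonneg : 0# ≤ ∑ D ν
        ∑ν-nonneg = ∑-nonneg (λ t → ∑-nonneg (λ y → 𝟙-nonneg (‖ x -ᵛ y ‖ ≟ t)) P) D
        ∈-Δ : ∀ y → Any (y ≋_) P → Any (‖ x -ᵛ y ‖ F.≈_) D
        ∈-Δ y y∈P = Membership.∈-deduplicate⁺ F.setoid _≟_ (λ p q → F.trans q (F.sym p))
          (Any.cartesianProductWith⁺ (λ x y → ‖ x -ᵛ y ‖)
            (λ p q → F.‖‖-cong (λ i → F.+-cong (p i) (F.-‿cong (q i)))) x∈P y∈P)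
        n≤∑ν : n ≤ ∑ D ν
        n≤∑ν = begin
          n                               ≈⟨ sym (trans (∑-const 1# P) (*-identityʳ n)) ⟩
          ∑[ y ∈ P ] 1#                   ≤⟨ ∑-mono-All (λ y y∈P → ≤∑-Any (λ t → ‖ x -ᵛ y ‖ ≟ t)
                                               (λ _ → <⇒≤ 0<1) (λ _ → ≤-refl) (∈-Δ y y∈P))
                                               self ⟩
          ∑[ y ∈ P ] ∑[ t ∈ D ] (at t y * 1#)
            ≈⟨ trans (∑-cong (λ y → ∑-cong (λ t → *-identityʳ _) D) P) (∑-comm _ P D) ⟩
          ∑ D ν                           ∎
        -- For equal distances at most one t in the repetition-free list contributes; for different
        -- ones no t matches both.
        collapse : ∀ y z → ∑[ t ∈ D ] (at t y * at t z) ≤ 𝟙 (‖ x -ᵛ y ‖ ≟ ‖ x -ᵛ z ‖)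
        collapse y z with ‖ x -ᵛ y ‖ ≟ ‖ x -ᵛ z ‖
        ... | yes _ = ≤-trans
          (∑-mono (λ t → 𝟙-*-≤ (‖ x -ᵛ y ‖ ≟ t) (𝟙-nonneg (‖ x -ᵛ z ‖ ≟ t)) (λ _ → ≤-refl)) D)
          (∑-𝟙-unique (λ t → ‖ x -ᵛ z ‖ ≟ t) (λ p q → F.trans (F.sym p) q)
            (UniqueDec.deduplicate-! decSetoid (cartesianProductWith (λ x y → ‖ x -ᵛ y ‖) P P)))
          where
          decSetoid : DecSetoid _ _
          decSetoid = record
            { isDecEquivalence = record { isEquivalence = F.isEquivalence ; _≟_ = _≟_ } }
        ... | no a≉b = ≤-trans
          (∑-mono (λ t → 𝟙-*-≤ (‖ x -ᵛ y ‖ ≟ t) ≤-refl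
            (λ a≈t → ≤-reflexive (𝟙-false (λ b≈t → a≉b (F.trans a≈t (F.sym b≈t))) (‖ x -ᵛ z ‖ ≟ t)))) D)
          (≤-reflexive (∑-0 D))

-- Real powers through the exponential

module RealPowers {r ℓ₁ ℓ₂} (R : RealNumbers r ℓ₁ ℓ₂) where
  open RealProperties R
  open Algebra.Properties.Semiring.Exp semiring using (^-congˡ)

  ln : ∀ n .{{_ : NonZero n}} → ℝ
  ln n = log (fromℕ n) (fromℕ-pos n)

  -- `_^ʳ_` unfolds only on a literal successor; this gives the formula for any base known to be
  -- nonzero.
  ^ʳ≈exp : ∀ n .{{_ : NonZero n}} x → n ^ʳ x ≈ exp (x * ln n)
  ^ʳ≈exp (suc n) x = refl

  ^-inverse : ∀ {x y} → x * y ≈ 1# → ∀ n → x ^ n * y ^ n ≈ 1#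
  ^-inverse xy≈1 zero = *-identityˡ 1#
  ^-inverse {x} {y} xy≈1 (suc n) = begin-equality
    x * x ^ n * (y * y ^ n)
      ≈⟨ solve 4 (λ x y u v → (x :* u) :* (y :* v) := (x :* y) :* (u :* v)) refl x y (x ^ n) (y ^ n) ⟩
    x * y * (x ^ n * y ^ n)  ≈⟨ *-cong xy≈1 (^-inverse xy≈1 n) ⟩
    1# * 1#                  ≈⟨ *-identityˡ 1# ⟩
    1#                       ∎
    where open ≤-Reasoning

  -- The Salem bound supplies n^(4-4s) and the size hypothesis n^(4s), the latter kept in
  -- exponential form; here their product becomes an integer power.
  [^ʳ1-s]⁴ : ∀ n .{{_ : NonZero n}} s →
    (n ^ʳ (1# - s)) ^ 4 * exp (fromℕ 4 * s * ln n) ≈ fromℕ n ^ 4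
  [^ʳ1-s]⁴ n s = begin-equality
    (n ^ʳ (1# - s)) ^ 4 * exp (fromℕ 4 * s * ln n)
      ≈⟨ *-congʳ (^-congˡ 4 (^ʳ≈exp n (1# - s))) ⟩
    exp ((1# - s) * ln n) ^ 4 * exp (fromℕ 4 * s * ln n)
      ≈⟨ *-congʳ (sym (exp-fromℕ-* 4 _)) ⟩
    exp (fromℕ 4 * ((1# - s) * ln n)) * exp (fromℕ 4 * s * ln n)
      ≈⟨ sym (exp-+ _ _) ⟩
    exp (fromℕ 4 * ((1# - s) * ln n) + fromℕ 4 * s * ln n)
      ≈⟨ exp-cong (trans
           (solve 4 (λ o s f l → f :* ((o :- s) :* l) :+ f :* s :* l := f :* (o :* l))
             refl 1# s (fromℕ 4) (ln n))
           (*-congˡ (*-identityˡ _))) ⟩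
    exp (fromℕ 4 * ln n)
      ≈⟨ exp-fromℕ-* 4 (ln n) ⟩
    exp (ln n) ^ 4
      ≈⟨ ^-congˡ 4 (exp-log (fromℕ n) (fromℕ-pos n)) ⟩
    fromℕ n ^ 4 ∎
    where open ≤-Reasoning

  -- Raising c q^((d+1)/(4s+1)) ≤ n to the power 4s + 1.
  threshold-power : ∀ {s c d n q} .{{_ : NonZero n}} .{{_ : NonZero q}}
    (0<e : 0# < fromℕ 4 * s + 1#) (0<c : 0# < c) →
    c * q ^ʳ (fromℕ (d ℕ.+ 1) ÷ (fromℕ 4 * s + 1#) [ 0<e ]) ≤ fromℕ n →
    exp ((fromℕ 4 * s + 1#) * log c 0<c) * (fromℕ q * fromℕ q ^ d) ≤
    fromℕ n * exp (fromℕ 4 * s * ln n)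
  threshold-power {s} {c} {d} {n} {q} 0<e 0<c h = begin
    exp (e * γ) * (fromℕ q * fromℕ q ^ d)
      ≡⟨ ≡.cong (λ k → exp (e * γ) * fromℕ q ^ k) (ℕ.+-comm 1 d) ⟩
    exp (e * γ) * fromℕ q ^ (d ℕ.+ 1)
      ≈⟨ *-congˡ (^-congˡ (d ℕ.+ 1) (sym (exp-log (fromℕ q) (fromℕ-pos q)))) ⟩
    exp (e * γ) * exp (ln q) ^ (d ℕ.+ 1)
      ≈⟨ *-congˡ (sym (exp-fromℕ-* (d ℕ.+ 1) (ln q))) ⟩
    exp (e * γ) * exp (D * ln q)
      ≈⟨ sym (exp-+ _ _) ⟩
    exp (e * γ + D * ln q)
      ≈⟨ exp-cong (+-congˡ (sym (trans
           (solve 4 (λ e D i l → e :* (D :* i :* l) := D :* ((e :* i) :* l)) refl e D (e ⁻¹[ 0<e ]) (ln q))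
           (*-congˡ (trans (*-congʳ (⁻¹-inverseʳ e 0<e)) (*-identityˡ _)))))) ⟩
    exp (e * γ + e * (D ÷ e [ 0<e ] * ln q))
      ≈⟨ exp-cong (sym (distribˡ e _ _)) ⟩
    exp (e * (γ + D ÷ e [ 0<e ] * ln q))
      -- Since exp reflects ≤, the hypothesis compares logarithms, and multiplying by the positive e
      -- = 4s + 1 clears the denominator of the exponent.
      ≤⟨ exp-mono-≤ (*-monoˡ-≤ (<⇒≤ 0<e) (exp-cancel-≤ h′)) ⟩
    exp (e * ln n)
      ≈⟨ exp-cong (trans (distribʳ (ln n) _ _) (+-congˡ (*-identityˡ _))) ⟩
    exp (fromℕ 4 * s * ln n + ln n)
      ≈⟨ exp-+ _ _ ⟩
    exp (fromℕ 4 * s * ln n) * exp (ln n)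
      ≈⟨ *-comm _ _ ⟩
    exp (ln n) * exp (fromℕ 4 * s * ln n)
      ≈⟨ *-congʳ (exp-log (fromℕ n) (fromℕ-pos n)) ⟩
    fromℕ n * exp (fromℕ 4 * s * ln n) ∎
    where
    open ≤-Reasoning
    e γ D : ℝ
    e = fromℕ 4 * s + 1#
    γ = log c 0<c
    D = fromℕ (d ℕ.+ 1)
    h′ : exp (γ + D ÷ e [ 0<e ] * ln q) ≤ exp (ln n)
    h′ = begin
      exp (γ + D ÷ e [ 0<e ] * ln q)          ≈⟨ exp-+ _ _ ⟩
      exp γ * exp (D ÷ e [ 0<e ] * ln q)      ≈⟨ *-cong (exp-log c 0<c) (sym (^ʳ≈exp q _)) ⟩
      c * q ^ʳ (D ÷ e [ 0<e ])                ≤⟨ h ⟩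
      fromℕ n                                 ≈⟨ sym (exp-log (fromℕ n) (fromℕ-pos n)) ⟩
      exp (ln n)                              ∎

-- From the Salem condition to a fourth moment bound

module _ {r ℓ₁ ℓ₂ f ℓ} (R : RealNumbers r ℓ₁ ℓ₂) (F : FiniteField f ℓ)
         (ψ : Fourier.AdditiveCharacter R F) {d} (E : Space.FiniteSubset F d) where
  open RealProperties R
  open RealPowers R
  open Sums R
  open FiniteField F using (order; order-nonZero)
  open Space F using (card; nonZeroVectors)
  open Fourier R F using (Is4Salem; q⁻ᵈ; Ê)
  open Complex R using (∣_∣²)
  open CharacterSums R F ψ
  open Energy E

  -- With w = q^(-d), the fourth power of the norm carries w⁵: one w from averaging and w⁴ from the
  -- normalisation of Ê. The Salem bound carries w⁴, so a single w remains, and inverting it gives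
  -- q^d.
  Salem⇒∑energy²≤ : ∀ s {C} → Is4Salem ψ E s C →
    ∑[ x ∈ nonZeroVectors d ] (energy x * energy x) ≤
    fromℕ order ^ d * (C ^ 4 * (card E ^ʳ (1# - s)) ^ 4)
  Salem⇒∑energy²≤ s {C} (N , (0≤N , N⁴≈) , N≤) = begin
    Q                        ≈⟨ sym (trans (*-congʳ qᵈw≈1) (*-identityˡ Q)) ⟩
    qᵈ * w * Q               ≈⟨ *-assoc qᵈ w Q ⟩
    qᵈ * (w * Q)
      ≤⟨ *-monoˡ-≤ (^-nonneg d (fromℕ-nonneg order)) (*-cancelˡ-≤ (^-pos 4 0<w) scaled) ⟩
    qᵈ * (C ^ 4 * W ^ 4)     ∎
    where
    open ≤-Reasoning
    V = nonZeroVectors d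
    w W Q qᵈ : ℝ
    w = q⁻ᵈ ψ E
    W = card E ^ʳ (1# - s)
    Q = ∑[ x ∈ V ] (energy x * energy x)
    qᵈ = fromℕ order ^ d
    0<w : 0# < w
    0<w = ^-pos d (⁻¹-pos (fromℕ order) (fromℕ-pos order))
    qᵈw≈1 : qᵈ * w ≈ 1#
    qᵈw≈1 = ^-inverse (⁻¹-inverseʳ (fromℕ order) (fromℕ-pos order)) d
    ∣Ê∣⁴≈ : ∀ x → ∣ Ê ψ E x ∣² ^ 2 ≈ w ^ 4 * (energy x * energy x)
    ∣Ê∣⁴≈ x = trans (*-cong (∣Ê∣²≈energy x) (*-congʳ (∣Ê∣²≈energy x)))
      -- `o` stands for the `1#` with which every unfolded power ends.
      (solve 3 (λ w e o → (w :* w :* e) :* ((w :* w :* e) :* o)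
        := (w :* (w :* (w :* (w :* o)))) :* (e :* e))
        refl w (energy x) 1#)
    scaled : w ^ 4 * (w * Q) ≤ w ^ 4 * (C ^ 4 * W ^ 4)
    scaled = begin
      w ^ 4 * (w * Q)
        ≈⟨ solve 3 (λ u w Q → u :* (w :* Q) := w :* (u :* Q)) refl (w ^ 4) w Q ⟩
      w * (w ^ 4 * Q)                  ≈⟨ *-congˡ (sym (trans (∑-cong ∣Ê∣⁴≈ V) (∑-*ˡ (w ^ 4) _ V))) ⟩
      w * ∑[ x ∈ V ] (∣ Ê ψ E x ∣² ^ 2) ≈⟨ sym N⁴≈ ⟩
      N ^ 4                            ≤⟨ ^-mono-≤ 4 0≤N N≤ ⟩
      (C * (w * W)) ^ 4
        ≈⟨ solve 3 (λ C w W → (C :* (w :* W)) :^ 4 := w :^ 4 :* (C :^ 4 :* W :^ 4)) refl C w W ⟩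
      w ^ 4 * (C ^ 4 * W ^ 4)          ∎

-- Constants and the final estimate

module _ {r ℓ₁ ℓ₂} (R : RealNumbers r ℓ₁ ℓ₂) where
  open RealProperties R

  -- Chosen so that 2 A ≤ L² κ, without extracting a square root.
  salemConstant : (A : ℝ) → ∀ κ → 0# < κ → ℝ
  salemConstant A κ 0<κ = 1# + (1# + 1#) * A ÷ κ [ 0<κ ]

  salemConstant-nonneg : ∀ {A κ} (0<κ : 0# < κ) → 0# ≤ A → 0# ≤ salemConstant A κ 0<κ
  salemConstant-nonneg 0<κ 0≤A = +-nonneg (<⇒≤ 0<1)
    (*-nonneg (*-nonneg (+-nonneg (<⇒≤ 0<1) (<⇒≤ 0<1)) 0≤A) (<⇒≤ (⁻¹-pos _ 0<κ)))

  -- For u = 2A/κ and L = 1 + u, the added 1 ensures L ≥ 1, whence u ≤ L ≤ L².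
  2A≤L²κ : ∀ {A κ} (0<κ : 0# < κ) → 0# ≤ A →
    let L = salemConstant A κ 0<κ in (1# + 1#) * A ≤ L * L * κ
  2A≤L²κ {A} {κ} 0<κ 0≤A = begin
    (1# + 1#) * A                ≈⟨ sym (*-identityʳ _) ⟩
    (1# + 1#) * A * 1#           ≈⟨ *-congˡ (sym (trans (*-comm _ _) (⁻¹-inverseʳ κ 0<κ))) ⟩
    (1# + 1#) * A * (κ ⁻¹[ 0<κ ] * κ)  ≈⟨ sym (*-assoc _ _ _) ⟩
    u * κ                        ≤⟨ *-mono-≤ 0≤u (<⇒≤ 0<κ) u≤L² ≤-refl ⟩
    L * L * κ                    ∎
    where
    open ≤-Reasoning
    u = (1# + 1#) * A ÷ κ [ 0<κ ]
    L = 1# + u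
    0≤u : 0# ≤ u
    0≤u = *-nonneg (*-nonneg (+-nonneg (<⇒≤ 0<1) (<⇒≤ 0<1)) 0≤A) (<⇒≤ (⁻¹-pos κ 0<κ))
    u≤L² : u ≤ L * L
    u≤L² = begin
      u        ≤⟨ x≤y+x (<⇒≤ 0<1) ⟩
      L        ≈⟨ sym (*-identityˡ L) ⟩
      1# * L   ≤⟨ *-mono-≤ (<⇒≤ 0<1) (+-nonneg (<⇒≤ 0<1) 0≤u) (x≤x+y 0≤u) ≤-refl ⟩
      L * L    ∎

  -- Here A is C⁴, and W and P play |E|^(4-4s) and |E|^(4s). Multiplying T² by κ lets κ q^(d+1) be
  -- replaced by n P, and W P = n⁴ then gives κ T² ≤ 2A n⁶ ≤ κ (L n³)².
  punctured-bound : ∀ {n q qᵈ A κ L P W T Q} → 0# < κ → 0# ≤ n → 0# ≤ q → 0# ≤ A → 0# ≤ L → 0# ≤ W →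
    (1# + 1#) * A ≤ L * L * κ →
    κ * (q * qᵈ) ≤ n * P →
    W * P ≈ n ^ 4 →
    Q ≤ qᵈ * (A * W) →
    T * T ≤ n * (q * ((1# + 1#) * Q)) →
    T ≤ L * (n * (n * n))
  punctured-bound {n} {q} {qᵈ} {A} {κ} {L} {P} {W} {T} {Q} 0<κ 0≤n 0≤q 0≤A 0≤L 0≤W 2A≤ large WP≈ Q≤ T²≤ =
    *-cancel-square-≤ (*-nonneg 0≤L (*-nonneg 0≤n (square-nonneg n))) (*-cancelˡ-≤ 0<κ (begin
      κ * (T * T)
        ≤⟨ *-monoˡ-≤ (<⇒≤ 0<κ) (≤-trans T²≤
             (*-monoˡ-≤ 0≤n (*-monoˡ-≤ 0≤q (*-monoˡ-≤ 0≤2 Q≤)))) ⟩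
      κ * (n * (q * (2ʳ * (qᵈ * (A * W)))))
        ≈⟨ solve 7 (λ κ n q t qᵈ A W → κ :* (n :* (q :* (t :* (qᵈ :* (A :* W)))))
             := t :* A :* (n :* W) :* (κ :* (q :* qᵈ))) refl κ n q 2ʳ qᵈ A W ⟩
      2ʳ * A * (n * W) * (κ * (q * qᵈ))
        ≤⟨ *-monoˡ-≤ (*-nonneg (*-nonneg 0≤2 0≤A) (*-nonneg 0≤n 0≤W)) large ⟩
      2ʳ * A * (n * W) * (n * P)
        ≈⟨ solve 4 (λ a n W P → a :* (n :* W) :* (n :* P)
             := n :* n :* (W :* P) :* a) refl (2ʳ * A) n W P ⟩
      n * n * (W * P) * (2ʳ * A)
        ≤⟨ *-monoˡ-≤ (*-nonneg (square-nonneg n) (≤-trans (^-nonneg 4 0≤n) (≤-reflexive (sym WP≈)))) 2A≤ ⟩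
      n * n * (W * P) * (L * L * κ)
        ≈⟨ *-congʳ (*-congˡ (trans WP≈
             (solve 2 (λ n o → n :* (n :* (n :* (n :* o))) := n :* n :* (n :* n) :* o) refl n 1#))) ⟩
      n * n * (n * n * (n * n) * 1#) * (L * L * κ)
        ≈⟨ *-congʳ (*-congˡ (*-identityʳ _)) ⟩
      n * n * (n * n * (n * n)) * (L * L * κ)
        ≈⟨ solve 3 (λ n L κ → n :* n :* (n :* n :* (n :* n)) :* (L :* L :* κ)
             := κ :* (L :* (n :* (n :* n)) :* (L :* (n :* (n :* n))))) refl n L κ ⟩
      κ * (L * (n * (n * n)) * (L * (n * (n * n)))) ∎))
    where
    open ≤-Reasoning
    2ʳ = 1# + 1#
    0≤2 : 0# ≤ 2ʳ
    0≤2 = +-nonneg (<⇒≤ 0<1) (<⇒≤ 0<1)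

theorem10 : ∀ {r ℓ₁ ℓ₂ f ℓ : Level} (R : RealNumbers r ℓ₁ ℓ₂) →
    let open Reals R in
    (d : ℕ) → 3 ℕ.≤ d →
    (s : ℝ) (1/4≤s : 1/ 4 ≤ s) → s ≤ 1/ 2 →
    (C c : ℝ) → 0# < C → 0# < c →
    ∃[ δ ] 0# < δ ×
    ((F : FiniteField f ℓ) →
    let open FiniteField F using (Carrier)
        open FiniteField F using (order)
        open FiniteField F using (_≉_)
        open FiniteField F using () renaming (0# to 0ᶠ)
        open Space F
        open Fourier R F
    in
    2 ∤ order →
    (ψ : AdditiveCharacter) → Nontrivial ψ →
    (j : Carrier) → j ≉ 0ᶠ →
    (E : FiniteSubset d) → E ⊆S j →
    Is4Salem ψ E s C →
    c * order ^ʳ (fromℕ (d ℕ.+ 1) ÷ (fromℕ 4 * s + 1#) [ 0<4s+1 1/4≤s ]) ≤ fromℕ (card E) →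
    δ * fromℕ order ≤ fromℕ (length (Δ E)))
theorem10 {f = f} {ℓ} R d 3≤d s 1/4≤s s≤1/2 C c 0<C 0<c = δ , ⁻¹-pos (1# + L) 0<1+L , bound
  where
  open RealProperties R
  open RealPowers R
  0<e = 0<4s+1 1/4≤s
  -- This is c^(4s+1), the constant of the size hypothesis after it is raised to the power 4s + 1.
  κ = exp ((fromℕ 4 * s + 1#) * log c 0<c)
  0<κ : 0# < κ
  0<κ = exp-pos _
  0≤C⁴ : 0# ≤ C ^ 4
  0≤C⁴ = ^-nonneg 4 (<⇒≤ 0<C)
  L = salemConstant R (C ^ 4) κ 0<κ
  0≤L : 0# ≤ L
  0≤L = salemConstant-nonneg R 0<κ 0≤C⁴
  0<1+L : 0# < 1# + L
  0<1+L = +-pos-nonneg 0<1 0≤L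
  -- The estimates end in q |E|³ ≤ |Δ(E)| (1 + L) |E|³, which dictates this value.
  δ = (1# + L) ⁻¹[ 0<1+L ]

  nonZero : ∀ {n} → 0# < fromℕ n → NonZero n
  nonZero {zero} 0<0 = contradiction 0<0 (<-irrefl refl)
  nonZero {suc n} _ = _

  module _ (F : FiniteField f ℓ) where
    open FiniteField F using (Carrier; order; order-nonZero; _≉_) renaming (0# to 0ᶠ)
    open Space F
    open Fourier R F

    bound : 2 ∤ order → (ψ : AdditiveCharacter) → Nontrivial ψ →
      (j : Carrier) → j ≉ 0ᶠ → (E : FiniteSubset d) → E ⊆S j → Is4Salem ψ E s C →
      c * order ^ʳ (fromℕ (d ℕ.+ 1) ÷ (fromℕ 4 * s + 1#) [ 0<e ]) ≤ fromℕ (card E) →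
      δ * fromℕ order ≤ fromℕ (length (Δ E))
    bound 2∤q ψ nontrivial j j≉0 E E⊆S salem large = *-cancelˡ-≤ 0<1+L (*-cancelˡ-≤ 0<n³ (begin
      n³ * ((1# + L) * (δ * q))
        ≈⟨ *-congˡ (trans (sym (*-assoc _ _ _))
             (trans (*-congʳ (⁻¹-inverseʳ (1# + L) 0<1+L)) (*-identityˡ q))) ⟩
      n³ * q
        ≤⟨ *-mono-≤ (<⇒≤ 0<n³) (fromℕ-nonneg order) (card³≤∣Δ∣*triangles) ≤-refl ⟩
      m * triangles * q
        ≈⟨ solve 3 (λ m t q → m :* t :* q := m :* (q :* t)) refl m triangles q ⟩
      m * (q * triangles)
        ≤⟨ *-monoˡ-≤ (fromℕ-nonneg (length (Δ E))) (≤-trans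
             (order*triangles≤∑energy E⊆S j≉0 (FieldProperties.2≉0 F 2∤q) nontrivial)
             (∑energy≤card³+punctured E⊆S j≉0)) ⟩
      m * (n³ + punctured E⊆S j≉0)
        ≤⟨ *-monoˡ-≤ (fromℕ-nonneg (length (Δ E))) (+-mono-≤ ≤-refl
             (punctured-bound R 0<κ (fromℕ-nonneg (card E)) (fromℕ-nonneg order) 0≤C⁴ 0≤L
               (^-nonneg 4 0≤W) (2A≤L²κ R 0<κ 0≤C⁴) (threshold-power {d = d} 0<e 0<c large)
               ([^ʳ1-s]⁴ (card E) s) (Salem⇒∑energy²≤ R F ψ E s salem) (punctured²≤ E⊆S j≉0))) ⟩
      m * (n³ + L * n³)
        ≈⟨ trans (*-congˡ (trans (+-congʳ (sym (*-identityˡ n³))) (sym (distribʳ n³ 1# L))))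
             (solve 3 (λ m a n → m :* (a :* n) := n :* (a :* m)) refl m (1# + L) n³) ⟩
      n³ * ((1# + L) * m) ∎))
      where
      open ≤-Reasoning
      open CharacterSums R F ψ
      open Energy E
      n q m n³ : ℝ
      n = fromℕ (card E)
      q = fromℕ order
      m = fromℕ (length (Δ E))
      n³ = n * (n * n)
      -- The threshold is positive, so E is nonempty: |E| has a logarithm and |E|³ can be cancelled.
      0<n : 0# < n
      0<n = <-≤-trans (*-pos 0<c (<-respʳ-≈ (sym (^ʳ≈exp order _)) (exp-pos _))) large
      instance
        card-nonZero : NonZero (card E)
        card-nonZero = nonZero 0<n
      0<n³ : 0# < n³
      0<n³ = *-pos 0<n (*-pos 0<n 0<n)
      0≤W : 0# ≤ card E ^ʳ (1# - s)
      0≤W = <⇒≤ (<-respʳ-≈ (sym (^ʳ≈exp (card E) _)) (exp-pos _))
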